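{- There are, up to isomorphism, precisely three $T_3$-snarks.
   Context: All graphs are finite and loopless; edge colorings are proper. A snark is a cyclically $4$-edge connected cubic graph of girth at least $5$ admitting no $3$-edge coloring. $T_3$ is the unique tree with all vertex degrees in $\{1,3\}$ having a $3$-valent vertex with distance $3$ to all leaves (it has $22$ vertices, $12$ of which are leaves). A $T_3$-snark is a snark which has a spanning tree isomorphic to $T_3$. -}

module Defs where

open import Data.Empty using (⊥-elim)
open import Data.Fin.Base using (Fin; zero; suc; toℕ; fromℕ; inject₁; _↑ˡ_)
open import Data.Fin.Patterns using (0F; 1F; 2F; 3F; 4F; 5F; 6F; 7F; 8F; 9F)
open import Data.Fin.Properties using (_≟_; all?; toℕ<n; toℕ-injective; toℕ-fromℕ; toℕ-fromℕ<; toℕ-inject₁; suc-injective)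
open import Data.Fin.Subset using (Subset; inside; outside; ∁; ∣_∣)
open import Data.List.Base using (allFin; filter; length)
open import Data.Nat.Base using (ℕ; zero; suc; _+_; _%_; _<_; _≤_; NonZero; s≤s)
open import Data.Nat.DivMod using (_mod_; m%n<n; n%n≡0; m<n⇒m%n≡m)
import Data.Nat.Properties as ℕ
open import Data.Product.Base using (Σ-syntax; ∃-syntax; _×_; _,_; proj₁; proj₂)
open import Data.Sum.Base using (_⊎_; inj₁; inj₂; swap)
open import Data.Vec.Base using (Vec; []; _∷_; lookup; replicate) renaming (_++_ to _V++_)
open import Function.Bundles using (_↔_; Inverse)
open import Function.Definitions using (Injective)
open import Relation.Binary.PropositionalEquality using (_≡_; _≢_; refl; sym; trans; cong; subst)
open import Relation.Nullary using (¬_; Dec)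
open import Relation.Nullary.Decidable using (¬?; _⊎-dec_; _→-dec_; from-yes)

-- Finite loopless graphs; parallel edges are allowed.  The orientation of an
-- edge given by the pair `ends e` carries no meaning.
record Graph : Set where
  field
    order    : ℕ
    size     : ℕ
    ends     : Fin size → Fin order × Fin order
    loopless : ∀ e → proj₁ (ends e) ≢ proj₂ (ends e)

  V : Set
  V = Fin order

  E : Set
  E = Fin size

  Joins : E → V → V → Set
  Joins e u v = (ends e ≡ (u , v)) ⊎ (ends e ≡ (v , u))

  Incident : V → E → Set
  Incident v e = (v ≡ proj₁ (ends e)) ⊎ (v ≡ proj₂ (ends e))

  incident? : ∀ v e → Dec (Incident v e)
  incident? v e = (v ≟ proj₁ (ends e)) ⊎-dec (v ≟ proj₂ (ends e))

  degree : V → ℕ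
  degree v = length (filter (incident? v) (allFin size))

open Graph public using (order; size)

-- For a bijection on edges, preserving the two ends of every edge already
-- implies reflecting them.
record _≅_ (G H : Graph) : Set where
  private
    module G = Graph G
    module H = Graph H
  field
    vertices : G.V ↔ H.V
    edges    : G.E ↔ H.E
    joins    : ∀ e u v → G.Joins e u v →
               H.Joins (Inverse.to edges e) (Inverse.to vertices u) (Inverse.to vertices v)

infix 4 _≅_

-- The increasing enumeration of the elements of a subset.
member : ∀ {n} (S : Subset n) → Fin ∣ S ∣ → Fin n
member (inside  ∷ S) zero    = zero
member (inside  ∷ S) (suc i) = suc (member S i)
member (outside ∷ S) i       = suc (member S i)

spanningSubgraph : (G : Graph) → Subset (size G) → Graph
spanningSubgraph G S = record
  { order    = order G
  ; size     = ∣ S ∣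
  ; ends     = λ i → Graph.ends G (member S i)
  ; loopless = λ i → Graph.loopless G (member S i)
  }

deleteEdges : (G : Graph) → Subset (size G) → Graph
deleteEdges G F = spanningSubgraph G (∁ F)

module _ (G : Graph) where
  open Graph G using (V; E; Joins; Incident; degree)

  data Walk : V → V → ℕ → Set where
    []   : ∀ {v} → Walk v v 0
    step : ∀ {u v w n} (e : E) → Joins e u v → Walk v w n → Walk u w (suc n)

  Linked : V → V → Set
  Linked u v = ∃[ n ] Walk u v n

  Connected : Set
  Connected = ∀ u v → Linked u v

  Distance : V → V → ℕ → Set
  Distance u v d = Walk u v d × (∀ n → Walk u v n → d ≤ n)

  -- Cycles of length k.  Distinctness of the edges matters only for k = 2,
  -- where it says that the cycle consists of two parallel edges; there is no
  -- cycle of length 1 as there are no loops.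
  record Cycle (k : ℕ) .{{_ : NonZero k}} : Set where
    field
      vertex           : Fin k → V
      edge             : Fin k → E
      vertex-injective : Injective _≡_ _≡_ vertex
      edge-injective   : Injective _≡_ _≡_ edge
      joins            : ∀ i → Joins (edge i) (vertex i) (vertex (suc (toℕ i) mod k))

  Acyclic : Set
  Acyclic = ∀ k .{{_ : NonZero k}} → ¬ Cycle k

  IsTree : Set
  IsTree = Connected × Acyclic

  GirthAtLeast : ℕ → Set
  GirthAtLeast g = ∀ k .{{_ : NonZero k}} → Cycle k → g ≤ k

  Cubic : Set
  Cubic = ∀ v → degree v ≡ 3

  EdgeColoring : ℕ → Set
  EdgeColoring n =
    Σ[ c ∈ (E → Fin n) ]
      (∀ e f v → e ≢ f → Incident v e → Incident v f → c e ≢ c f)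

  -- The component of v contains a cycle.
  CyclicComponent : V → Set
  CyclicComponent v =
    ∃[ k ] Σ[ C ∈ Cycle (suc k) ] (∀ i → Linked v (Cycle.vertex C i))

  HasTwoCyclicComponents : Set
  HasTwoCyclicComponents =
    ∃[ u ] ∃[ v ] (¬ Linked u v) × CyclicComponent u × CyclicComponent v

CyclicallyEdgeConnected : ℕ → Graph → Set
CyclicallyEdgeConnected k G =
  ∀ (F : Subset (size G)) → ∣ F ∣ < k → ¬ HasTwoCyclicComponents (deleteEdges G F)

record IsSnark (G : Graph) : Set where
  field
    cyclically4EdgeConnected : CyclicallyEdgeConnected 4 G
    cubic                    : Cubic G
    girth≥5                  : GirthAtLeast G 5
    not3EdgeColorable        : ¬ EdgeColoring G 3

-- The defining property of T₃.
record IsT₃ (T : Graph) : Set where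
  open Graph T using (V; degree)
  field
    isTree         : IsTree T
    degrees-1-or-3 : ∀ v → degree v ≡ 1 ⊎ degree v ≡ 3
    centre         : V
    centre-degree  : degree centre ≡ 3
    leaf-distance  : ∀ w → degree w ≡ 1 → Distance T centre w 3

-- T₃ itself: vertex 0 is the centre, and edge i joins vertex i + 1 to its
-- parent; vertices 1-3, 4-9 and 10-21 are at distance 1, 2 and 3 from 0.
parent : Fin 21 → Fin 22
parent i = lookup parents i ↑ˡ 12
  where
  parents : Vec (Fin 10) 21
  parents = 0F ∷ 0F ∷ 0F ∷
            1F ∷ 1F ∷ 2F ∷ 2F ∷ 3F ∷ 3F ∷
            4F ∷ 4F ∷ 5F ∷ 5F ∷ 6F ∷ 6F ∷ 7F ∷ 7F ∷ 8F ∷ 8F ∷ 9F ∷ 9F ∷ []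

T₃ : Graph
T₃ = record
  { order    = 22
  ; size     = 21
  ; ends     = λ i → parent i , suc i
  ; loopless = from-yes (all? λ i → ¬? (parent i ≟ suc i))
  }

T₃-isT₃ : IsT₃ T₃
T₃-isT₃ = record
  { isTree         = connected , acyclic
  ; degrees-1-or-3 = from-yes (all? λ v → (degree v ℕ.≟ 1) ⊎-dec (degree v ℕ.≟ 3))
  ; centre         = 0F
  ; centre-degree  = refl
  ; leaf-distance  = λ w leaf →
      subst (Walk T₃ 0F w) (leaf-depth w leaf) (descend w) ,
      λ n p → subst (_≤ n) (leaf-depth w leaf) (depth-bound p)
  }
  where
  open Graph T₃ using (V; E; Joins; degree)

  _++_ : ∀ {u v w m n} → Walk T₃ u v m → Walk T₃ v w n → Walk T₃ u w (m + n)
  []         ++ q = q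
  step e j p ++ q = step e j (p ++ q)

  reverse : ∀ {u v n} → Walk T₃ u v n → Linked T₃ v u
  reverse []           = 0 , []
  reverse (step e j p) = _ , proj₂ (reverse p) ++ step e (swap j) []

  depth : V → ℕ
  depth v = lookup (0 ∷ replicate 3 1 V++ replicate 6 2 V++ replicate 12 3) v

  depth-parent : ∀ i → depth (suc i) ≡ depth (parent i) + 1
  depth-parent = from-yes (all? λ i → depth (suc i) ℕ.≟ depth (parent i) + 1)

  depth-zero : ∀ v → depth v ≡ 0 → v ≡ 0F
  depth-zero = from-yes (all? λ v → (depth v ℕ.≟ 0) →-dec (v ≟ 0F))

  leaf-depth : ∀ v → degree v ≡ 1 → depth v ≡ 3
  leaf-depth = from-yes (all? λ v → (degree v ℕ.≟ 1) →-dec (depth v ℕ.≟ 3))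

  descend′ : ∀ d v → depth v ≡ d → Walk T₃ 0F v d
  descend′ zero    v       eq with refl ← depth-zero v eq = []
  descend′ (suc d) (suc i) eq =
    subst (Walk T₃ 0F (suc i)) (ℕ.+-comm d 1)
      (descend′ d (parent i) (ℕ.+-cancelʳ-≡ 1 _ d
        (trans (sym (depth-parent i)) (trans eq (ℕ.+-comm 1 d))))
       ++ step i (inj₁ refl) [])

  descend : ∀ v → Walk T₃ 0F v (depth v)
  descend v = descend′ (depth v) v refl

  connected : Connected T₃
  connected u v = _ , proj₂ (reverse (descend u)) ++ descend v

  depth-joins : ∀ {e u v} → Joins e u v → depth v ≤ suc (depth u)
  depth-joins {e} (inj₁ refl) = ℕ.≤-reflexive (trans (depth-parent e) (ℕ.+-comm _ 1))
  depth-joins {e} (inj₂ refl) =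
    ℕ.m≤n⇒m≤1+n (subst (depth (parent e) ≤_) (sym (depth-parent e)) (ℕ.m≤m+n _ 1))

  depth-walk : ∀ {u v n} → Walk T₃ u v n → depth v ≤ n + depth u
  depth-walk []                       = ℕ.≤-refl
  depth-walk (step {u} {n = n} e j p) =
    ℕ.≤-trans (depth-walk p)
      (ℕ.≤-trans (ℕ.+-monoʳ-≤ n (depth-joins j)) (ℕ.≤-reflexive (ℕ.+-suc n (depth u))))

  depth-bound : ∀ {v n} → Walk T₃ 0F v n → depth v ≤ n
  depth-bound {v} {n} p = subst (depth v ≤_) (ℕ.+-identityʳ n) (depth-walk p)

  parent< : ∀ i → toℕ (parent i) < toℕ (suc i)
  parent< = from-yes (all? λ i → toℕ (parent i) ℕ.<? toℕ (suc i))

  upper-end : ∀ {e u v} → Joins e u v → toℕ u ≤ toℕ v → suc e ≡ v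
  upper-end     (inj₁ refl) u≤v = refl
  upper-end {e} (inj₂ refl) u≤v = ⊥-elim (ℕ.<⇒≱ (parent< e) u≤v)

  maximum : ∀ {k} (f : Fin (suc k) → ℕ) → ∃[ i ] ∀ j → f j ≤ f i
  maximum {zero}  f = zero , λ { zero → ℕ.≤-refl }
  maximum {suc k} f with maximum (λ i → f (suc i))
  ... | i , max with ℕ.≤-total (f zero) (f (suc i))
  ...   | inj₁ le = suc i , λ { zero → le ; (suc j) → max j }
  ...   | inj₂ ge = zero , λ { zero → ℕ.≤-refl ; (suc j) → ℕ.≤-trans (max j) ge }

  predecessor : ∀ {k} (i : Fin (suc k)) → ∃[ j ] suc (toℕ j) mod suc k ≡ i
  predecessor {k} i = let j , eq = go i in
    j , toℕ-injective (trans (toℕ-fromℕ< (m%n<n (suc (toℕ j)) (suc k))) eq)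
    where
    go : (i : Fin (suc k)) → ∃[ j ] suc (toℕ {suc k} j) % suc k ≡ toℕ i
    go zero    = fromℕ k ,
      trans (cong (λ n → suc n % suc k) (toℕ-fromℕ k)) (n%n≡0 (suc k))
    go (suc i) = inject₁ i ,
      trans (cong (λ n → suc n % suc k) (toℕ-inject₁ i)) (m<n⇒m%n≡m (s≤s (toℕ<n i)))

  -- Both edges of a cycle at its largest vertex would lead to the parent.
  acyclic : Acyclic T₃
  acyclic (suc k) C = Graph.loopless T₃ (edge i) (loop (joins i))
    where
    open Cycle C

    i : Fin (suc k)
    i = proj₁ (maximum (λ i → toℕ (vertex i)))

    max : ∀ j → toℕ (vertex j) ≤ toℕ (vertex i)
    max = proj₂ (maximum (λ i → toℕ (vertex i)))

    j : Fin (suc k)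
    j = proj₁ (predecessor i)

    next-j : suc (toℕ j) mod suc k ≡ i
    next-j = proj₂ (predecessor i)

    i≡j : i ≡ j
    i≡j = edge-injective (suc-injective (trans
      (upper-end (swap (joins i)) (max _))
      (sym (upper-end (subst (λ x → Joins (edge j) (vertex j) (vertex x)) next-j (joins j)) (max j)))))

    next-i : suc (toℕ i) mod suc k ≡ i
    next-i = trans (cong (λ x → suc (toℕ x) mod suc k) i≡j) next-j

    loop : Joins (edge i) (vertex i) (vertex (suc (toℕ i) mod suc k)) →
           parent (edge i) ≡ suc (edge i)
    loop p with subst (λ x → Joins (edge i) (vertex i) (vertex x)) next-i p
    ... | inj₁ eq = trans (cong proj₁ eq) (sym (cong proj₂ eq))
    ... | inj₂ eq = trans (cong proj₁ eq) (sym (cong proj₂ eq))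

HasSpanningTree≅ : Graph → Graph → Set
HasSpanningTree≅ G T =
  Σ[ S ∈ Subset (size G) ] IsTree (spanningSubgraph G S) × spanningSubgraph G S ≅ T

record IsT₃Snark (G : Graph) : Set where
  field
    isSnark         : IsSnark G
    spanningTree≅T₃ : HasSpanningTree≅ G T₃

{-# OPTIONS --safe #-}
-- Deleting a spanning T₃ from a cubic graph leaves a 2-regular graph on the
-- twelve leaves. Its cycles are explored leaf by leaf up to the symmetries of
-- T₃: a candidate for the next leaf is skipped if the exchange of two sibling
-- subtrees that contain no visited leaf makes it smaller. The search carries
-- along the proper 3-edge-colourings of T₃ together with the traversed part of
-- the cycles, so that a complete exploration ends either with a 3-edge-colouring
-- or with one of 42 edge sets, each of which forms with T₃ one of six graphs.
-- Three of these have an edge cut of size at most 3 with a cycle on both sides;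
-- the others are the snarks.
module Submission where

open import Defs
open import Data.Bool.Base using (Bool; true; false; T; not; _∧_; _∨_; _xor_; if_then_else_)
open import Data.Bool.ListAction using (any; all)
open import Data.Bool.Properties as Bool using (T-∧; T-∨; T-≡; not-injective; xor-same)
open import Data.Empty using (⊥; ⊥-elim)
open import Data.Fin using (#_)
open import Data.Fin.Base as Fin using (Fin; zero; suc; toℕ; inject₁; _↑ˡ_; _↑ʳ_; splitAt)
open import Data.Fin.Induction using (<-weakInduction; <-wellFounded)
open import Data.Fin.Patterns
open import Data.Fin.Properties as Fin using (_≟_; _<?_; any?; all?; pigeonhole; injective⇒≤; suc-injective; toℕ-injective; toℕ-inject₁; toℕ-fromℕ<; toℕ<n)
open import Data.Fin.Subset using (Subset; inside; outside; ∁; ∣_∣)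
open import Data.List.Base as List using (List; []; _∷_; _++_; map; filter; concatMap; allFin)
open import Data.List.Membership.Propositional using (_∈_; _∉_; find)
open import Data.List.Membership.Propositional.Properties using (∈-allFin; ∈-filter⁺; ∈-filter⁻; ∈-lookup; ∈-map⁺; ∈-map⁻)
import Data.List.Membership.DecPropositional as DecMembership
open import Data.List.Relation.Unary.All as All using (All; []; _∷_)
import Data.List.Relation.Unary.All.Properties as All
open import Data.List.Relation.Unary.AllPairs using (AllPairs; []; _∷_)
open import Data.List.Relation.Unary.Any as Any using (Any; here; there)
import Data.List.Relation.Unary.Any.Properties as Any
open import Data.List.Relation.Unary.Unique.Propositional using (Unique)
import Data.List.Relation.Unary.Unique.Propositional.Properties as Unique
open import Data.Maybe.Base using (Maybe; just; nothing; is-just)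
open import Data.Nat.Base as ℕ using (ℕ; zero; suc; NonZero; _≤_; z≤n; s≤s)
open import Data.Nat.DivMod using (_mod_; m%n<n; m<n⇒m%n≡m)
import Data.Nat.Properties as ℕ
open import Data.Nat.Properties using (≤-reflexive; ≤-trans)
open import Data.Product.Base as × using (Σ-syntax; ∃-syntax; _×_; _,_; proj₁; proj₂)
open import Data.Product.Properties using (≡-dec; ,-injective)
open import Data.Sum.Base as Sum using (_⊎_; inj₁; inj₂; [_,_]′; swap)
open import Data.Vec.Base as Vec using (Vec; []; _∷_; lookup; tabulate)
open import Data.Vec.Properties using (lookup∘tabulate; lookup-map; lookup-++ʳ)
open import Function.Base using (_∘_; id)
open import Function.Bundles using (_↔_; Equivalence; Inverse; mk⇔; mk↔ₛ′)
open import Function.Construct.Identity using (↔-id)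
open import Function.Construct.Symmetry using (↔-sym)
open import Function.Definitions using (Injective)
open import Induction.WellFounded using (Acc; acc)
open import Relation.Binary.PropositionalEquality
open import Relation.Binary.PropositionalEquality.Properties using (subst-injective)
open import Relation.Nullary using (¬_; Dec; yes; no; contradiction; True; toWitness; ¬?; _×-dec_; _⊎-dec_)
open import Relation.Nullary.Decidable using (does; does-⇔; dec-true; dec-false; from-yes; _→-dec_; ¬¬-excluded-middle)

-- The pruning by symmetry needs no canonical forms. If `n` is skipped because an exchange takes it
-- to a smaller leaf, relabelling `G` by that exchange turns the edge towards `n` into an edge
-- towards the smaller leaf, and induction on `n` ends at a candidate that is explored. The exchange
-- fixes every visited leaf, so the recorded edges and colourings remain valid although the
-- labelling has changed. The colourings serve as a filter. With the colours at the centre fixed,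
-- `T₃` has 2^9 proper 3-edge-colourings, and each of them extends along a cycle of leaves in at
-- most two ways, decided at its first leaf. All are followed at once, and one survivor at the end
-- rules the graph out. Identifying the remaining graphs takes only a vertex bijection that
-- preserves edges, because a cubic graph leaves no room for further ones. The cyclic connectivity
-- of a snark enters after the search, to discard the graphs with small cuts.

lookup-injective : ∀ {A : Set} {xs : List A} → Unique xs → Injective _≡_ _≡_ (List.lookup xs)
lookup-injective (_ AllPairs.∷ _)  {zero}  {zero}  _  = refl
lookup-injective (x∉ AllPairs.∷ _) {zero}  {suc j} eq = contradiction eq (All.lookup x∉ (∈-lookup j))
lookup-injective (x∉ AllPairs.∷ _) {suc i} {zero}  eq = contradiction (sym eq) (All.lookup x∉ (∈-lookup i))
lookup-injective (_ AllPairs.∷ u)  {suc i} {suc j} eq = cong suc (lookup-injective u eq)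

xor-false⇒≡ : ∀ a b → a xor b ≡ false → a ≡ b
xor-false⇒≡ true  true  _ = refl
xor-false⇒≡ false false _ = refl

≡⇒xor-false : ∀ {a b} → a ≡ b → a xor b ≡ false
≡⇒xor-false {a} refl = xor-same a

↔-injective : ∀ {A B : Set} (φ : A ↔ B) → Injective _≡_ _≡_ (Inverse.to φ)
↔-injective φ eq = trans (sym (φ.strictlyInverseʳ _)) (trans (cong φ.from eq) (φ.strictlyInverseʳ _))
  where module φ = Inverse φ

next : ∀ {k} .{{_ : NonZero k}} → Fin k → Fin k
next {k} i = suc (toℕ i) mod k

-- Fails only for `k = 2`, where the second edge of a closed walk may be the first one traversed
-- backwards.
Nondegenerate : ∀ k .{{_ : NonZero k}} → Set
Nondegenerate k = ∀ (i j : Fin k) → i ≡ next j → j ≡ next i → i ≡ j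

nondegenerate? : ∀ k .{{_ : NonZero k}} → Dec (Nondegenerate k)
nondegenerate? k = all? λ i → all? λ j → (i ≟ next j) →-dec (j ≟ next i) →-dec (i ≟ j)

next-inject₁ : ∀ {k} (i : Fin k) → next (inject₁ i) ≡ suc i
next-inject₁ {k} i = toℕ-injective (trans (toℕ-fromℕ< (m%n<n (suc (toℕ (inject₁ i))) (suc k)))
  (trans (cong (λ m → suc m ℕ.% suc k) (toℕ-inject₁ i)) (m<n⇒m%n≡m (s≤s (toℕ<n i)))))

-- Adjacency, neighbourhoods in cubic graphs, and short cycles

module _ (G : Graph) where
  open Graph G using (V; E; ends; loopless; Joins; Incident; incident?; degree)

  Adj : V → V → Set
  Adj u v = ∃[ e ] Joins e u v

  Simple : Set
  Simple = ∀ {e f u v} → Joins e u v → Joins f u v → e ≡ f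

module _ {G : Graph} where
  open Graph G using (V; E; ends; loopless; Joins; Incident; incident?; degree)

  adj-sym : ∀ {u v} → Adj G u v → Adj G v u
  adj-sym (e , j) = e , swap j

  adj-irrefl : ∀ {u} → ¬ Adj G u u
  adj-irrefl (e , inj₁ eq) = loopless e (trans (cong proj₁ eq) (sym (cong proj₂ eq)))
  adj-irrefl (e , inj₂ eq) = loopless e (trans (cong proj₁ eq) (sym (cong proj₂ eq)))

  joins-functional : ∀ {e u v w} → Joins e u v → Joins e u w → v ≡ w
  joins-functional (inj₁ p) (inj₁ q) = cong proj₂ (trans (sym p) q)
  joins-functional (inj₁ p) (inj₂ q) =
    trans (cong proj₂ (trans (sym p) q)) (cong proj₁ (trans (sym p) q))
  joins-functional (inj₂ p) (inj₁ q) =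
    trans (cong proj₁ (trans (sym p) q)) (cong proj₂ (trans (sym p) q))
  joins-functional (inj₂ p) (inj₂ q) = cong proj₁ (trans (sym p) q)

  joins-endpoints : ∀ {e a b c d} → Joins e a b → Joins e c d →
                    (a ≡ c × b ≡ d) ⊎ (a ≡ d × b ≡ c)
  joins-endpoints (inj₁ p) (inj₁ q) = inj₁ (,-injective (trans (sym p) q))
  joins-endpoints (inj₁ p) (inj₂ q) = inj₂ (,-injective (trans (sym p) q))
  joins-endpoints (inj₂ p) (inj₁ q) with refl ← trans (sym p) q = inj₂ (refl , refl)
  joins-endpoints (inj₂ p) (inj₂ q) with refl ← trans (sym p) q = inj₁ (refl , refl)

  joins⇒incident : ∀ {e u v} → Joins e u v → Incident u e
  joins⇒incident (inj₁ p) = inj₁ (sym (cong proj₁ p))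
  joins⇒incident (inj₂ p) = inj₂ (sym (cong proj₂ p))

  incident⇒joins : ∀ {e u} → Incident u e → ∃[ v ] Joins e u v
  incident⇒joins (inj₁ refl) = _ , inj₁ refl
  incident⇒joins (inj₂ refl) = _ , inj₂ refl

  incidence : V → List E
  incidence v = filter (incident? v) (allFin (size G))

  joins⇒∈ : ∀ {e u v} → Joins e u v → e ∈ incidence u
  joins⇒∈ {e} {u} j = ∈-filter⁺ (incident? u) (∈-allFin e) (joins⇒incident j)

  -- As `degree u` is the length of the list of edges at `u`, indices into this list turn the
  -- counting of neighbours into a pigeonhole argument.
  position : ∀ {u v} → Adj G u v → Fin (degree u)
  position (e , j) = Any.index (joins⇒∈ j)

  position-injective : ∀ {u v w} (p : Adj G u v) (q : Adj G u w) → position p ≡ position q → v ≡ w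
  position-injective (e , i) (f , j) eq =
    joins-functional i (subst (λ e → Joins e _ _) (sym e≡f) j)
    where
    e≡f : e ≡ f
    e≡f = trans (Any.lookup-index (joins⇒∈ i))
                (trans (cong (List.lookup (incidence _)) eq) (sym (Any.lookup-index (joins⇒∈ j))))

  -- Four neighbours share three positions, so two of them coincide, and `x`, `y`, `z` are distinct.
  cubic-exhaustive : ∀ {v x y z w} → degree v ≡ 3 → x ≢ y → x ≢ z → y ≢ z →
                     Adj G v x → Adj G v y → Adj G v z → Adj G v w →
                     w ≡ x ⊎ w ≡ y ⊎ w ≡ z
  cubic-exhaustive {v} {x} {y} {z} {w} deg x≢y x≢z y≢z vx vy vz vw =
    let i , j , i<j , eq = pigeonhole (s≤s (≤-reflexive deg)) (λ i → position (adj i))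
    in result i j i<j (position-injective (adj i) (adj j) eq)
    where
    end : Fin 4 → V
    end i = Vec.lookup (w ∷ x ∷ y ∷ z ∷ []) i

    adj : ∀ i → Adj G v (end i)
    adj 0F = vw
    adj 1F = vx
    adj 2F = vy
    adj 3F = vz

    result : ∀ i j → toℕ i ℕ.< toℕ j → end i ≡ end j → w ≡ x ⊎ w ≡ y ⊎ w ≡ z
    result 0F 1F _ eq = inj₁ eq
    result 0F 2F _ eq = inj₂ (inj₁ eq)
    result 0F 3F _ eq = inj₂ (inj₂ eq)
    result 1F 2F _ eq = contradiction eq x≢y
    result 1F 3F _ eq = contradiction eq x≢z
    result 2F 3F _ eq = contradiction eq y≢z
    result 1F 1F (s≤s ()) _
    result 2F 1F (s≤s ()) _
    result 2F 2F (s≤s (s≤s ())) _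
    result 3F 1F (s≤s ()) _
    result 3F 2F (s≤s (s≤s ())) _
    result 3F 3F (s≤s (s≤s (s≤s ()))) _

  simple⇒≡ : Simple G → ∀ {e f a b c d} → Joins e a b → Joins f c d →
             (a ≡ c × b ≡ d) ⊎ (a ≡ d × b ≡ c) → e ≡ f
  simple⇒≡ simple i j (inj₁ (refl , refl)) = simple i j
  simple⇒≡ simple i j (inj₂ (refl , refl)) = simple i (swap j)

  record Trio (v : V) : Set where
    field
      nbr           : Fin 3 → V
      nbr-injective : Injective _≡_ _≡_ nbr
      nbr-adj       : ∀ i → Adj G v (nbr i)

    exhaustive : degree v ≡ 3 → ∀ {w} → Adj G v w → ∃[ i ] w ≡ nbr i
    exhaustive deg vw with cubic-exhaustive deg
      ((λ ()) ∘ nbr-injective {0F} {1F}) ((λ ()) ∘ nbr-injective {0F} {2F}) ((λ ()) ∘ nbr-injective {1F} {2F})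
      (nbr-adj 0F) (nbr-adj 1F) (nbr-adj 2F) vw
    ... | inj₁ eq = 0F , eq
    ... | inj₂ (inj₁ eq) = 1F , eq
    ... | inj₂ (inj₂ eq) = 2F , eq

  trio : Simple G → ∀ v → degree v ≡ 3 → Trio v
  trio simple v deg = record
    { nbr           = λ i → proj₁ (other i)
    ; nbr-injective = λ {i} {j} eq → subst-injective (sym deg) (lookup-injective unique
        (simple (proj₂ (other i)) (subst (Joins _ v) (sym eq) (proj₂ (other j)))))
    ; nbr-adj       = λ i → _ , proj₂ (other i)
    }
    where
    unique = Unique.filter⁺ (incident? v) (Unique.allFin⁺ (size G))

    cast : Fin 3 → Fin (degree v)
    cast = subst Fin (sym deg)

    other : ∀ i → ∃[ w ] Joins (List.lookup (incidence v) (cast i)) v w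
    other i = incident⇒joins
      (proj₂ (∈-filter⁻ (incident? v) {xs = allFin (size G)} (∈-lookup {xs = incidence v} (cast i))))

  -- Two parallel edges would form a 2-cycle. This form serves both graphs of girth at least 5 and,
  -- through acyclicity, `T₃`.
  noDigon⇒simple : ¬ Cycle G 2 → Simple G
  noDigon⇒simple noDigon {e} {f} {u} {v} i j with e ≟ f
  ... | yes e≡f = e≡f
  ... | no  e≢f = contradiction digon noDigon
    where
    digon : Cycle G 2
    digon = record
      { vertex           = Vec.lookup (u ∷ v ∷ [])
      ; edge             = Vec.lookup (e ∷ f ∷ [])
      ; vertex-injective = λ
          { {0F} {0F} _  → refl
          ; {0F} {1F} eq → contradiction (e , subst (Joins e u) (sym eq) i) adj-irrefl
          ; {1F} {0F} eq → contradiction (e , subst (Joins e u) eq i) adj-irrefl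
          ; {1F} {1F} _  → refl
          }
      ; edge-injective   = λ
          { {0F} {0F} _  → refl
          ; {0F} {1F} eq → contradiction eq e≢f
          ; {1F} {0F} eq → contradiction (sym eq) e≢f
          ; {1F} {1F} _  → refl
          }
      ; joins            = λ { 0F → i ; 1F → swap j }
      }

  cycle : ∀ {k} .{{_ : NonZero k}} (v : Fin k → V) → Injective _≡_ _≡_ v →
          (∀ i → Adj G (v i) (v (next i))) →
          Nondegenerate k → Cycle G k
  cycle v v-injective adj nondegenerate = record
    { vertex           = v
    ; edge             = λ i → proj₁ (adj i)
    ; vertex-injective = v-injective
    ; edge-injective   = λ {i} {j} → edge-injective i j
    ; joins            = λ i → proj₂ (adj i)
    }
    where
    edge-injective : ∀ i j → proj₁ (adj i) ≡ proj₁ (adj j) → i ≡ j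
    edge-injective i j eq with joins-endpoints (proj₂ (adj i)) (subst (λ e → Joins e _ _) (sym eq) (proj₂ (adj j)))
    ... | inj₁ (p , _) = v-injective p
    -- The edge is traversed in opposite directions at `i` and `j`, so each index is the successor
    -- of the other.
    ... | inj₂ (p , q) = nondegenerate i j (v-injective p) (sym (v-injective q))

  module _ (girth : GirthAtLeast G 5) where

    girth⇒simple : Simple G
    girth⇒simple = noDigon⇒simple λ c → contradiction (girth 2 c) λ { (s≤s (s≤s ())) }

    no-triangle : ∀ {a b c} → Adj G a b → Adj G b c → ¬ Adj G c a
    no-triangle {a} {b} {c} ab bc ca = contradiction (girth 3 triangle) λ { (s≤s (s≤s (s≤s ()))) }
      where
      distinct : ∀ {u v} → Adj G u v → u ≢ v
      distinct uv refl = adj-irrefl uv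

      triangle : Cycle G 3
      triangle = cycle (Vec.lookup (a ∷ b ∷ c ∷ []))
        (λ
          { {0F} {0F} _  → refl
          ; {0F} {1F} eq → contradiction eq (distinct ab)
          ; {0F} {2F} eq → contradiction (sym eq) (distinct ca)
          ; {1F} {0F} eq → contradiction (sym eq) (distinct ab)
          ; {1F} {1F} _  → refl
          ; {1F} {2F} eq → contradiction eq (distinct bc)
          ; {2F} {0F} eq → contradiction eq (distinct ca)
          ; {2F} {1F} eq → contradiction (sym eq) (distinct bc)
          ; {2F} {2F} _  → refl
          })
        (λ { 0F → ab ; 1F → bc ; 2F → ca })
        (from-yes (nondegenerate? 3))

    no-square : ∀ {a b c d} → a ≢ c → b ≢ d → Adj G a b → Adj G b c → Adj G c d → ¬ Adj G d a
    no-square {a} {b} {c} {d} a≢c b≢d ab bc cd da =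
      contradiction (girth 4 square) λ { (s≤s (s≤s (s≤s (s≤s ())))) }
      where
      distinct : ∀ {u v} → Adj G u v → u ≢ v
      distinct uv refl = adj-irrefl uv

      square : Cycle G 4
      square = cycle (Vec.lookup (a ∷ b ∷ c ∷ d ∷ []))
        (λ
          { {0F} {0F} _  → refl
          ; {0F} {1F} eq → contradiction eq (distinct ab)
          ; {0F} {2F} eq → contradiction eq a≢c
          ; {0F} {3F} eq → contradiction (sym eq) (distinct da)
          ; {1F} {0F} eq → contradiction (sym eq) (distinct ab)
          ; {1F} {1F} _  → refl
          ; {1F} {2F} eq → contradiction eq (distinct bc)
          ; {1F} {3F} eq → contradiction eq b≢d
          ; {2F} {0F} eq → contradiction (sym eq) a≢c
          ; {2F} {1F} eq → contradiction (sym eq) (distinct bc)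
          ; {2F} {2F} _  → refl
          ; {2F} {3F} eq → contradiction eq (distinct cd)
          ; {3F} {0F} eq → contradiction eq (distinct da)
          ; {3F} {1F} eq → contradiction (sym eq) b≢d
          ; {3F} {2F} eq → contradiction (sym eq) (distinct cd)
          ; {3F} {3F} _  → refl
          })
        (λ { 0F → ab ; 1F → bc ; 2F → cd ; 3F → da })
        (from-yes (nondegenerate? 4))

-- Isomorphisms

-- As `joins` goes in one direction only, an edge `f` of `H` is compared with the image of its
-- preimage, which is `f` itself; an edge determines its ends up to order.
≅-sym : ∀ {G H} → G ≅ H → H ≅ G
≅-sym {G} {H} iso = record
  { vertices = ↔-sym vertices
  ; edges    = ↔-sym edges
  ; joins    = reflects
  }
  where
  open _≅_ iso
  module φ = Inverse vertices
  module ε = Inverse edges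

  reflects : ∀ f u v → Graph.Joins H f u v → Graph.Joins G (ε.from f) (φ.from u) (φ.from v)
  reflects f u v j with joins-endpoints {H} j
    (subst (λ f → Graph.Joins H f _ _) (ε.strictlyInverseˡ f) (joins (ε.from f) _ _ (inj₁ refl)))
  ... | inj₁ (refl , refl) = inj₁ (sym (cong₂ _,_ (φ.strictlyInverseʳ _) (φ.strictlyInverseʳ _)))
  ... | inj₂ (refl , refl) = inj₂ (sym (cong₂ _,_ (φ.strictlyInverseʳ _) (φ.strictlyInverseʳ _)))

module _ {G H : Graph} (iso : G ≅ H) where
  open _≅_ iso
  private
    module φ = Inverse vertices
    module ε = Inverse edges

  adj-map : ∀ {u v} → Adj G u v → Adj H (φ.to u) (φ.to v)
  adj-map (e , j) = ε.to e , joins e _ _ j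

  walk-map : ∀ {u v n} → Walk G u v n → Walk H (φ.to u) (φ.to v) n
  walk-map []           = []
  walk-map (step e j w) = step (ε.to e) (joins e _ _ j) (walk-map w)

  cycle-map : ∀ {k} .{{_ : NonZero k}} → Cycle G k → Cycle H k
  cycle-map C = record
    { vertex           = φ.to ∘ C.vertex
    ; edge             = ε.to ∘ C.edge
    ; vertex-injective = C.vertex-injective ∘ ↔-injective vertices
    ; edge-injective   = C.edge-injective ∘ ↔-injective edges
    ; joins            = λ i → joins _ _ _ (C.joins i)
    }
    where module C = Cycle C

tree-map : ∀ {G H} → G ≅ H → IsTree G → IsTree H
tree-map {G} {H} iso (connected , acyclic) =
  (λ u v → let n , w = connected (φ.from u) (φ.from v) in
           n , subst₂ (λ u v → Walk H u v n) (φ.strictlyInverseˡ u) (φ.strictlyInverseˡ v) (walk-map iso w)) ,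
  λ k C → acyclic k (cycle-map (≅-sym iso) C)
  where module φ = Inverse (_≅_.vertices iso)

-- The three neighbours of `u` have distinct images, which use up the degree of `f u`. It is applied
-- to embeddings of cubic graphs and, at inner vertices, to the embedding of `T₃`.
image-exhaustive : ∀ {G H u} (t : Trio {H} u) {f : Graph.V H → Graph.V G} → Injective _≡_ _≡_ f →
  (∀ {v} → Adj H u v → Adj G (f u) (f v)) → Graph.degree G (f u) ≡ 3 →
  ∀ {w} → Adj G (f u) w → ∃[ i ] w ≡ f (Trio.nbr t i)
image-exhaustive {G} {H} {u} t {f} f-injective forward = Trio.exhaustive image
  where
  image : Trio {G} (f u)
  image = record
    { nbr           = f ∘ Trio.nbr t
    ; nbr-injective = Trio.nbr-injective t ∘ f-injective
    ; nbr-adj       = forward ∘ Trio.nbr-adj t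
    }

-- An embedding of cubic simple graphs that is bijective on vertices is an
-- isomorphism: at each vertex the three neighbours are already accounted for.
cubic-embedding⇒≅ : ∀ {G H} → Simple G → Simple H → Cubic G → Cubic H →
  (φ : Graph.V H ↔ Graph.V G) →
  (∀ e → Adj G (Inverse.to φ (proj₁ (Graph.ends H e))) (Inverse.to φ (proj₂ (Graph.ends H e)))) →
  G ≅ H
cubic-embedding⇒≅ {G} {H} simple-G simple-H cubic-G cubic-H φ preserves = record
  { vertices = ↔-sym φ
  ; edges    = mk↔ₛ′ (proj₁ ∘ to) (proj₁ ∘ from)
      (λ f → simple⇒≡ {H} simple-H (proj₂ (to _)) (inj₁ refl)
        (Sum.map (×.map (λ p → trans (cong φ.from p) (φ.strictlyInverseʳ _)) (λ q → trans (cong φ.from q) (φ.strictlyInverseʳ _)))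
                 (×.map (λ p → trans (cong φ.from p) (φ.strictlyInverseʳ _)) (λ q → trans (cong φ.from q) (φ.strictlyInverseʳ _)))
                 (joins-endpoints {G} (inj₁ refl) (proj₂ (from f)))))
      (λ e → simple⇒≡ {G} simple-G (proj₂ (from _)) (inj₁ refl)
        (Sum.map (×.map (λ p → trans (cong φ.to p) (φ.strictlyInverseˡ _)) (λ q → trans (cong φ.to q) (φ.strictlyInverseˡ _)))
                 (×.map (λ p → trans (cong φ.to p) (φ.strictlyInverseˡ _)) (λ q → trans (cong φ.to q) (φ.strictlyInverseˡ _)))
                 (joins-endpoints {H} (inj₁ refl) (proj₂ (to e)))))
  ; joins    = λ e u v → λ where
      (inj₁ refl) → proj₂ (to e)
      (inj₂ refl) → swap (proj₂ (to e))
  }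
  where
  module φ = Inverse φ

  forward : ∀ {u v} → Adj H u v → Adj G (φ.to u) (φ.to v)
  forward (e , inj₁ refl) = preserves e
  forward (e , inj₂ refl) = adj-sym {G} (preserves e)

  backward : ∀ {u v} → Adj G (φ.to u) (φ.to v) → Adj H u v
  backward {u} a with t ← trio simple-H u (cubic-H u)
    with i , eq ← image-exhaustive {G} {H} t (↔-injective φ) forward (cubic-G (φ.to u)) a =
    subst (Adj H u) (sym (↔-injective φ eq)) (Trio.nbr-adj t i)

  from : ∀ f → Adj G (φ.to (proj₁ (Graph.ends H f))) (φ.to (proj₂ (Graph.ends H f)))
  from f = preserves f

  to : ∀ e → Adj H (φ.from (proj₁ (Graph.ends G e))) (φ.from (proj₂ (Graph.ends G e)))
  to e = backward (subst₂ (Adj G) (sym (φ.strictlyInverseˡ _)) (sym (φ.strictlyInverseˡ _)) (e , inj₁ refl))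

-- Edge cuts

member-inside : ∀ {n} (S : Subset n) j → Vec.lookup S (member S j) ≡ inside
member-inside (inside  ∷ S) zero    = refl
member-inside (inside  ∷ S) (suc j) = member-inside S j
member-inside (outside ∷ S) j       = member-inside S j

member-injective : ∀ {n} (S : Subset n) → Injective _≡_ _≡_ (member S)
member-injective (inside  ∷ S) {zero}  {zero}  _  = refl
member-injective (inside  ∷ S) {suc i} {suc j} eq = cong suc (member-injective S (Fin.suc-injective eq))
member-injective (outside ∷ S) eq                 = member-injective S (Fin.suc-injective eq)

member-surjective : ∀ {n} (S : Subset n) i → Vec.lookup S i ≡ inside → ∃[ j ] member S j ≡ i
member-surjective (inside  ∷ S) zero    _  = zero , refl
member-surjective (inside  ∷ S) (suc i) eq = ×.map suc (cong suc) (member-surjective S i eq)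
member-surjective (outside ∷ S) (suc i) eq = ×.map id (cong suc) (member-surjective S i eq)

∣∣-injection : ∀ {m n} (S : Subset m) (T : Subset n) {f : Fin m → Fin n} → Injective _≡_ _≡_ f →
  (∀ i → Vec.lookup S i ≡ inside → Vec.lookup T (f i) ≡ inside) → ∣ S ∣ ≤ ∣ T ∣
∣∣-injection S T {f} f-injective f-inside = injective⇒≤ {f = proj₁ ∘ g} λ {i} {j} eq →
  member-injective S (f-injective (trans (sym (proj₂ (g i))) (trans (cong (member T) eq) (proj₂ (g j)))))
  where
  g : ∀ i → ∃[ j ] member T j ≡ f (member S i)
  g i = member-surjective T _ (f-inside _ (member-inside S i))

module _ (G : Graph) where
  open Graph G using (V; E; ends)

  crosses : (V → Bool) → E → Bool
  crosses side e = side (proj₁ (ends e)) xor side (proj₂ (ends e))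

  cut : (V → Bool) → Subset (size G)
  cut side = tabulate (crosses side)

  -- The edges stay existential, so that the same vertices give a cycle after the edges of the cut
  -- have been deleted and renumbered.
  record CycleOn (side : V → Bool) (b : Bool) : Set where
    field
      {length-1}       : ℕ
      vertex           : Fin (suc length-1) → V
      vertex-injective : Injective _≡_ _≡_ vertex
      vertex-adj       : ∀ i → Adj G (vertex i) (vertex (next i))
      nondegenerate    : Nondegenerate (suc length-1)
      on-side          : ∀ i → side (vertex i) ≡ b

  record SmallCyclicCut : Set where
    field
      side     : V → Bool
      small    : ∣ cut side ∣ ≤ 3
      cyclic   : ∀ b → CycleOn side b

module _ {G : Graph} where
  open Graph G using (V; E; ends; Joins)

  adj-outside : ∀ (F : Subset (size G)) {u v} ((e , _) : Adj G u v) →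
                Vec.lookup F e ≡ outside → Adj (deleteEdges G F) u v
  adj-outside F (e , j) eq =
    let i , i≡e = member-surjective (∁ F) e (trans (lookup-map e not F) (cong not eq)) in
    i , subst (λ e → Joins e _ _) (sym i≡e) j

  crosses-outside : ∀ (side : V → Bool) {e u v} → Joins e u v → side u ≡ side v → crosses G side e ≡ false
  crosses-outside side (inj₁ refl) eq = ≡⇒xor-false eq
  crosses-outside side (inj₂ refl) eq = ≡⇒xor-false (sym eq)

  crosses-false : ∀ (side : V → Bool) {e u v} → Joins e u v → crosses G side e ≡ false → side u ≡ side v
  crosses-false side (inj₁ refl) eq = xor-false⇒≡ _ _ eq
  crosses-false side (inj₂ refl) eq = sym (xor-false⇒≡ _ _ eq)

  -- A walk that avoids the cut never changes sides; hence cycles on different sides lie in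
  -- different components.
  walk-side : ∀ (side : V → Bool) {u v n} → Walk (deleteEdges G (cut G side)) u v n → side u ≡ side v
  walk-side side []           = refl
  walk-side side (step e j w) = trans (crosses-false side j
    (trans (sym (lookup∘tabulate (crosses G side) _)) (not-injective (trans (sym (lookup-map _ not (cut G side))) (member-inside (∁ (cut G side)) e)))))
    (walk-side side w)

  walk-++ : ∀ {u v w m n} → Walk G u v m → Walk G v w n → Linked G u w
  walk-++ []           q = _ , q
  walk-++ (step e j p) q = _ , step e j (proj₂ (walk-++ p q))

  linked-trans : ∀ {u v w} → Linked G u v → Linked G v w → Linked G u w
  linked-trans (_ , p) (_ , q) = walk-++ p q

  linked-sym : ∀ {u v} → Linked G u v → Linked G v u
  linked-sym (_ , p) = go p
    where
    go : ∀ {u v n} → Walk G u v n → Linked G v u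
    go []           = _ , []
    go (step e j p) = linked-trans (go p) (_ , step e (swap j) [])

  adj⇒linked : ∀ {u v} → Adj G u v → Linked G u v
  adj⇒linked (e , j) = _ , step e j []

  linked-along : ∀ {k} (v : Fin (suc k) → V) → (∀ i → Adj G (v i) (v (next i))) → ∀ i → Linked G (v zero) (v i)
  linked-along v adj = <-weakInduction _ (_ , []) λ i linked →
    linked-trans linked (adj⇒linked (subst (λ j → Adj G (v (inject₁ i)) (v j)) (next-inject₁ i) (adj (inject₁ i))))

smallCut⇒¬cyclically4EdgeConnected : ∀ {G} → SmallCyclicCut G → ¬ CyclicallyEdgeConnected 4 G
smallCut⇒¬cyclically4EdgeConnected {G} c connected =
  connected F (s≤s small)
    ( vertex (cyclic true) zero , vertex (cyclic false) zero
    , (λ (_ , w) → true≢false (trans (sym (on-side (cyclic true) zero)) (trans (walk-side {G} side w) (on-side (cyclic false) zero))))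
    , component (cyclic true) , component (cyclic false) )
  where
  open SmallCyclicCut c
  open CycleOn
  F = cut G side

  true≢false : true ≢ false
  true≢false ()

  component : ∀ {b} (C : CycleOn G side b) → CyclicComponent (deleteEdges G F) (vertex C zero)
  component C = _ , cycle (vertex C) (vertex-injective C) adj (nondegenerate C) , linked-along (vertex C) adj
    where
    adj : ∀ i → Adj (deleteEdges G F) (vertex C i) (vertex C (next i))
    adj i = adj-outside {G} F (vertex-adj C i)
      (trans (lookup∘tabulate (crosses G side) _)
        (crosses-outside {G} side (proj₂ (vertex-adj C i)) (trans (on-side C i) (sym (on-side C (next i))))))

smallCut-map : ∀ {G H} → G ≅ H → SmallCyclicCut H → SmallCyclicCut G
smallCut-map {G} {H} iso c = record
  { side   = side ∘ φ.to
  ; small  = ≤-trans (∣∣-injection (cut G (side ∘ φ.to)) (cut H side) (↔-injective edges) inside-cut) small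
  ; cyclic = λ b → let open CycleOn (cyclic b) in record
      { vertex           = φ.from ∘ vertex
      ; vertex-injective = vertex-injective ∘ ↔-injective (↔-sym vertices)
      ; vertex-adj       = adj-map (≅-sym iso) ∘ vertex-adj
      ; nondegenerate    = nondegenerate
      ; on-side          = λ i → trans (cong side (φ.strictlyInverseˡ _)) (on-side i)
      }
  }
  where
  open _≅_ iso
  open SmallCyclicCut c
  module φ = Inverse vertices

  inside-cut : ∀ e → Vec.lookup (cut G (side ∘ φ.to)) e ≡ inside → Vec.lookup (cut H side) (Inverse.to edges e) ≡ inside
  inside-cut e eq with crosses H side (Inverse.to edges e) in f-eq
  ... | true  = trans (lookup∘tabulate (crosses H side) _) f-eq
  ... | false = contradiction
    (trans (sym eq) (trans (lookup∘tabulate (crosses G (side ∘ φ.to)) e)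
      (crosses-outside {G} (side ∘ φ.to) (inj₁ refl) (crosses-false {H} side (joins e _ _ (inj₁ refl)) f-eq))))
    λ ()

¬¬-∀ : ∀ {n} {P : Fin n → Set} → (∀ i → ¬ ¬ P i) → ¬ ¬ (∀ i → P i)
¬¬-∀ {zero}  _   k = k λ ()
¬¬-∀ {suc n} ¬¬p k = ¬¬p zero λ p₀ → ¬¬-∀ (¬¬p ∘ suc) λ p → k (Fin.∀-cons p₀ p)

-- The set of vertices linked to one of the two components is only decidable
-- up to double negation, which suffices as the goal is negative.
onlyTrivialCuts⇒cyclically4EdgeConnected : ∀ {G} →
  (∀ side → ∣ cut G side ∣ ≤ 3 → ∃[ b ] (∀ x y → side x ≡ b → side y ≡ b → x ≡ y)) →
  CyclicallyEdgeConnected 4 G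
onlyTrivialCuts⇒cyclically4EdgeConnected {G} trivial F (s≤s ∣F∣≤3) (u , v , ¬linked , Cᵤ , Cᵥ) =
  ¬¬-∀ (λ w → ¬¬-excluded-middle {A = Linked H u w}) λ linked? →
    let
      side = λ w → does (linked? w)

      same-side : ∀ {x y} → Linked H x y → side x ≡ side y
      same-side {x} {y} l = does-⇔ (mk⇔ (λ p → linked-trans p l) (λ p → linked-trans p (linked-sym l))) (linked? x) (linked? y)

      -- An edge that survives the deletion of `F` links its ends, so it cannot lead out of the set
      -- of vertices linked to `u`.
      cut-inside : ∀ e → Vec.lookup (cut G side) e ≡ inside → Vec.lookup F e ≡ inside
      cut-inside e eq = ≢outside⇒inside λ out → contradiction
        (trans (sym eq) (trans (lookup∘tabulate (crosses G side) e)
          (crosses-outside {G} side (inj₁ refl) (same-side (adj⇒linked (adj-outside {G} F (e , inj₁ refl) out))))))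
        λ ()

      b , unique = trivial side (≤-trans (∣∣-injection (cut G side) F id cut-inside) ∣F∣≤3)
    in refute side b unique
         (λ w l → dec-true (linked? w) l)
         (λ w l → dec-false (linked? w) λ l′ → ¬linked (linked-trans l′ (linked-sym l)))
  where
  H = deleteEdges G F

  ≢outside⇒inside : ∀ {b} → b ≢ outside → b ≡ inside
  ≢outside⇒inside {true}  _ = refl
  ≢outside⇒inside {false} f = contradiction refl f

  -- A cycle of length 1 would be a loop, so a cyclic component does not fit into a side with at
  -- most one vertex.
  two-vertices : ∀ {w} → CyclicComponent H w → ∃[ x ] ∃[ y ] x ≢ y × Linked H w x × Linked H w y
  two-vertices (zero  , C , _) = contradiction (_ , Cycle.joins C zero) (adj-irrefl {H})
  two-vertices (suc k , C , l) = _ , _ , (λ eq → contradiction (Cycle.vertex-injective C eq) λ ()) , l zero , l (suc zero)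

  refute : (side : Fin (order G) → Bool) → ∀ b → (∀ x y → side x ≡ b → side y ≡ b → x ≡ y) →
           (∀ w → Linked H u w → side w ≡ true) → (∀ w → Linked H v w → side w ≡ false) → ⊥
  refute side true  unique onᵤ _ with x , y , x≢y , lx , ly ← two-vertices Cᵤ = x≢y (unique x y (onᵤ x lx) (onᵤ y ly))
  refute side false unique _ onᵥ with x , y , x≢y , lx , ly ← two-vertices Cᵥ = x≢y (unique x y (onᵥ x lx) (onᵥ y ly))

adj? : ∀ G u v → Dec (Adj G u v)
adj? G u v = any? λ e → ≡-dec _≟_ _≟_ (ends e) (u , v) ⊎-dec ≡-dec _≟_ _≟_ (ends e) (v , u)
  where open Graph G using (ends)

-- The leaves of T₃

Leaf : Set
Leaf = Fin 12

leaf : Leaf → Fin 22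
leaf = 10 ↑ʳ_

inner : Fin 10 → Fin 22
inner = _↑ˡ 12

inner-or-leaf : ∀ v → (∃[ i ] v ≡ inner i) ⊎ (∃[ n ] v ≡ leaf n)
inner-or-leaf v with splitAt 10 v in eq
... | inj₁ i = inj₁ (i , sym (Fin.splitAt⁻¹-↑ˡ eq))
... | inj₂ n = inj₂ (n , sym (Fin.splitAt⁻¹-↑ʳ eq))

-- Edge `i` of `T₃` leads down to vertex `suc i`, and leaf `n` is vertex 10 + n; hence its pendant
-- edge is `9 ↑ʳ n`.
stem : Leaf → Fin 22
stem n = parent (9 ↑ʳ n)

sibling : Leaf → Leaf
sibling = lookup (1F ∷ 0F ∷ 3F ∷ 2F ∷ 5F ∷ 4F ∷ 7F ∷ 6F ∷ 9F ∷ 8F ∷ suc (suc 9F) ∷ suc 9F ∷ [])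

parent≢leaf : ∀ i n → parent i ≢ leaf n
parent≢leaf = from-yes (all? λ i → all? λ n → ¬? (parent i ≟ leaf n))

stem-sibling : ∀ n → stem (sibling n) ≡ stem n
stem-sibling = from-yes (all? λ n → stem (sibling n) ≟ stem n)

sibling≢ : ∀ n → sibling n ≢ n
sibling≢ = from-yes (all? λ n → ¬? (sibling n ≟ n))

leaf-injective : ∀ {m n} → leaf m ≡ leaf n → m ≡ n
leaf-injective = Fin.↑ʳ-injective 10 _ _

T₃-simple : Simple T₃
T₃-simple = noDigon⇒simple (proj₂ (IsT₃.isTree T₃-isT₃) 2)

inner-degree : ∀ i → Graph.degree T₃ (inner i) ≡ 3
inner-degree = from-yes (all? λ i → Graph.degree T₃ (inner i) ℕ.≟ 3)

abstract
  T₃-trio : ∀ i → Trio {T₃} (inner i)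
  T₃-trio i = trio T₃-simple (inner i) (inner-degree i)

leaf-edge : ∀ {e v n} → Graph.Joins T₃ e v (leaf n) → e ≡ 9 ↑ʳ n
leaf-edge         (inj₁ eq) = suc-injective (cong proj₂ eq)
leaf-edge {e} {n = n} (inj₂ eq) = contradiction (cong proj₁ eq) (parent≢leaf e n)

leaf-adj⇒stem : ∀ {v n} → Adj T₃ v (leaf n) → v ≡ stem n
leaf-adj⇒stem {n = n} (e , inj₁ eq) with refl ← leaf-edge {e} {n = n} (inj₁ eq) = sym (cong proj₁ eq)
leaf-adj⇒stem {n = n} (e , inj₂ eq) = contradiction (cong proj₁ eq) (parent≢leaf e n)

stem-adj : ∀ n → Adj T₃ (stem n) (leaf n)
stem-adj n = 9 ↑ʳ n , inj₁ refl

-- An automorphism of `T₃`, restricted to involutions so that it is its own inverse when a graph is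
-- relabelled. The search evaluates only the action `perm` on leaves.
record Symmetry : Set where
  field
    perm       : Vec Leaf 12
    full       : Vec (Fin 22) 22
    involutive : ∀ v → lookup full (lookup full v) ≡ v
    on-leaves  : ∀ n → lookup full (leaf n) ≡ leaf (lookup perm n)
    preserving : ∀ i → Adj T₃ (lookup full (parent i)) (lookup full (suc i))

  act : Leaf → Leaf
  act = lookup perm

  act-involutive : ∀ n → act (act n) ≡ n
  act-involutive n = leaf-injective
    (trans (sym (on-leaves (act n))) (trans (cong (lookup full) (sym (on-leaves n))) (involutive (leaf n))))

  full-adj : ∀ {u v} → Adj T₃ u v → Adj T₃ (lookup full u) (lookup full v)
  full-adj (i , inj₁ refl) = preserving i
  full-adj (i , inj₂ refl) = adj-sym {T₃} (preserving i)

exchange : List (ℕ × ℕ) → Fin 22 → Fin 22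
exchange []             v = v
exchange ((a , b) ∷ ps) v =
  if toℕ v ℕ.≡ᵇ a then b mod 22 else if toℕ v ℕ.≡ᵇ b then a mod 22 else exchange ps v

module _ (ps : List (ℕ × ℕ)) where
  exchange-full : Vec (Fin 22) 22
  exchange-full = tabulate (exchange ps)

  exchange-perm : Vec Leaf 12
  -- The default `0F` for an inner image is harmless: the second condition of `exchange-valid?`
  -- fails unless every leaf goes to a leaf.
  exchange-perm = tabulate λ n → [ (λ _ → 0F) , id ]′ (splitAt 10 (exchange ps (leaf n)))

  exchange-valid? : Dec
    ((∀ v → lookup exchange-full (lookup exchange-full v) ≡ v) ×
     (∀ n → lookup exchange-full (leaf n) ≡ leaf (lookup exchange-perm n)) ×
     (∀ i → Adj T₃ (lookup exchange-full (parent i)) (lookup exchange-full (suc i))))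
  exchange-valid? =
    all? (λ v → lookup exchange-full (lookup exchange-full v) ≟ v) ×-dec
    all? (λ n → lookup exchange-full (leaf n) ≟ leaf (lookup exchange-perm n)) ×-dec
    all? (λ i → adj? T₃ (lookup exchange-full (parent i)) (lookup exchange-full (suc i)))

  symmetry : {True exchange-valid?} → Symmetry
  symmetry {valid} = record
    { perm       = exchange-perm
    ; full       = exchange-full
    ; involutive = proj₁ (toWitness valid)
    ; on-leaves  = proj₁ (proj₂ (toWitness valid))
    ; preserving = proj₂ (proj₂ (toWitness valid))
    }

-- The exchanges of two sibling subtrees.
symmetries : List Symmetry
symmetries =
  symmetry ((1 , 2) ∷ (4 , 6) ∷ (5 , 7) ∷ (10 , 14) ∷ (11 , 15) ∷ (12 , 16) ∷ (13 , 17) ∷ []) ∷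
  symmetry ((1 , 3) ∷ (4 , 8) ∷ (5 , 9) ∷ (10 , 18) ∷ (11 , 19) ∷ (12 , 20) ∷ (13 , 21) ∷ []) ∷
  symmetry ((2 , 3) ∷ (6 , 8) ∷ (7 , 9) ∷ (14 , 18) ∷ (15 , 19) ∷ (16 , 20) ∷ (17 , 21) ∷ []) ∷
  symmetry ((4 , 5) ∷ (10 , 12) ∷ (11 , 13) ∷ []) ∷
  symmetry ((6 , 7) ∷ (14 , 16) ∷ (15 , 17) ∷ []) ∷
  symmetry ((8 , 9) ∷ (18 , 20) ∷ (19 , 21) ∷ []) ∷
  symmetry ((10 , 11) ∷ []) ∷ symmetry ((12 , 13) ∷ []) ∷ symmetry ((14 , 15) ∷ []) ∷
  symmetry ((16 , 17) ∷ []) ∷ symmetry ((18 , 19) ∷ []) ∷ symmetry ((20 , 21) ∷ []) ∷ []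

-- Three distinct values are not covered by two. This yields a neighbour of a leaf other than its
-- stem and the leaf from which it was reached.
avoid-two : ∀ {n} {f : Fin 3 → Fin n} → Injective _≡_ _≡_ f → ∀ a b → ∃[ i ] f i ≢ a × f i ≢ b
avoid-two {f = f} f-injective a b with any? (λ i → ¬? (f i ≟ a) ×-dec ¬? (f i ≟ b))
... | yes found = found
... | no  none  = contradiction (pigeonhole (s≤s (s≤s (s≤s z≤n))) side) λ where
        (i , j , i<j , eq) → contradiction (f-injective (side-injective i j eq)) (Fin.<⇒≢ i<j)
  where
  covered : ∀ i → f i ≡ a ⊎ f i ≡ b
  covered i with f i ≟ a | f i ≟ b
  ... | yes p | _     = inj₁ p
  ... | no  _ | yes q = inj₂ q
  ... | no ¬p | no ¬q = contradiction (i , ¬p , ¬q) none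

  side : Fin 3 → Fin 2
  side i = [ (λ _ → 0F) , (λ _ → 1F) ]′ (covered i)

  side-injective : ∀ i j → side i ≡ side j → f i ≡ f j
  side-injective i j eq with covered i | covered j
  ... | inj₁ p | inj₁ q = trans p (sym q)
  ... | inj₂ p | inj₂ q = trans p (sym q)
  ... | inj₁ _ | inj₂ _ = contradiction eq λ ()
  ... | inj₂ _ | inj₁ _ = contradiction eq λ ()

-- Embedded spanning copies of `T₃` and the edges between their leaves

record Labelling (G : Graph) : Set where
  field
    vertices : Fin 22 ↔ Graph.V G
    tree     : ∀ {u v} → Adj T₃ u v → Adj G (Inverse.to vertices u) (Inverse.to vertices v)

  open Inverse vertices public using () renaming (to to at; from to of; strictlyInverseˡ to at-of; strictlyInverseʳ to of-at)

  Near : Fin 22 → Fin 22 → Set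
  Near u v = Adj G (at u) (at v)

record Partners {G : Graph} (L : Labelling G) (m n : Leaf) : Set where
  constructor partners
  field
    near : Labelling.Near L (leaf m) (leaf n)

partners-sym : ∀ {G} {L : Labelling G} {m n} → Partners L m n → Partners L n m
partners-sym {G} (partners near) = partners (adj-sym {G} near)

partners-irrefl : ∀ {G} {L : Labelling G} {m n} → Partners L m n → m ≢ n
partners-irrefl {G} (partners near) refl = adj-irrefl {G} near

-- The embedded tree remains the same subgraph of `G`; only the numbering of its vertices changes.
relabel : ∀ {G} → Labelling G → Symmetry → Labelling G
relabel L σ = record
  { vertices = mk↔ₛ′ (at ∘ lookup full) (lookup full ∘ of)
      (λ v → trans (cong at (involutive (of v))) (at-of v))
      (λ v → trans (cong (lookup full) (of-at _)) (involutive v))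
  ; tree     = tree ∘ full-adj
  }
  where
  open Labelling L
  open Symmetry σ

module _ {G : Graph} (cubic : Cubic G) (girth : GirthAtLeast G 5) (L : Labelling G) where
  open Labelling L

  at-injective : Injective _≡_ _≡_ at
  at-injective = ↔-injective vertices

  near-inner : ∀ i {v} → Near (inner i) v → Adj T₃ (inner i) v
  near-inner i near with j , eq ← image-exhaustive {G} (T₃-trio i) at-injective tree (cubic _) near
    with refl ← at-injective eq = Trio.nbr-adj (T₃-trio i) j

  -- An inner vertex spends its whole degree on `T₃`, so an edge outside the tree has leaves at both
  -- ends.
  near-cases : ∀ {u v} → Near u v → Adj T₃ u v ⊎ (∃[ m ] ∃[ n ] u ≡ leaf m × v ≡ leaf n)
  near-cases {u} {v} near with inner-or-leaf u | inner-or-leaf v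
  ... | inj₁ (i , refl) | _               = inj₁ (near-inner i near)
  ... | inj₂ _          | inj₁ (j , refl) = inj₁ (adj-sym {T₃} (near-inner j (adj-sym {G} near)))
  ... | inj₂ (m , p)    | inj₂ (n , q)    = inj₂ (m , n , p , q)

  near-stem : ∀ n → Near (leaf n) (stem n)
  near-stem n = adj-sym {G} (tree (stem-adj n))

  -- Besides its stem a leaf has two more neighbours, which are leaves, and one of them differs from
  -- `p`. With `p` the previous leaf this continues a path.
  partner-avoiding : ∀ m p → ∃[ n ] Partners L m n × n ≢ p
  partner-avoiding m p
    with t ← trio {G} (girth⇒simple {G} girth) (at (leaf m)) (cubic _)
    with i , ≢stem , ≢p ← avoid-two (Trio.nbr-injective t) (at (stem m)) (at (leaf p))
    with near ← subst (Adj G (at (leaf m))) (sym (at-of (Trio.nbr t i))) (Trio.nbr-adj t i)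
    with near-cases near
  ... | inj₁ adj = contradiction (trans (sym (at-of _)) (cong at (leaf-adj⇒stem (adj-sym {T₃} adj)))) ≢stem
  ... | inj₂ (_ , n , _ , eq) = n , partners (subst (Near (leaf m)) eq near) ,
        λ { refl → ≢p (trans (sym (at-of _)) (cong at eq)) }

  stem≢leaf : ∀ m n → at (stem m) ≢ at (leaf n)
  stem≢leaf m n = parent≢leaf (9 ↑ʳ m) n ∘ at-injective

  partner-exhaustive : ∀ {m x y n} → x ≢ y → Partners L m x → Partners L m y → Partners L m n → n ≡ x ⊎ n ≡ y
  partner-exhaustive {m} {x} {y} {n} x≢y (partners mx) (partners my) (partners mn) = cases
    (cubic-exhaustive {G} (cubic (at (leaf m))) (stem≢leaf m x) (stem≢leaf m y)
      (x≢y ∘ leaf-injective ∘ at-injective) (near-stem m) mx my mn)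
    where
    cases : at (leaf n) ≡ at (stem m) ⊎ at (leaf n) ≡ at (leaf x) ⊎ at (leaf n) ≡ at (leaf y) →
            n ≡ x ⊎ n ≡ y
    cases (inj₁ eq)        = contradiction (sym eq) (stem≢leaf m n)
    cases (inj₂ (inj₁ eq)) = inj₁ (leaf-injective (at-injective eq))
    cases (inj₂ (inj₂ eq)) = inj₂ (leaf-injective (at-injective eq))

  -- The two leaves and their stem would form a triangle.
  ¬partner-sibling : ∀ {m} → ¬ Partners L m (sibling m)
  ¬partner-sibling {m} (partners near) = no-triangle {G} girth near
    (subst (Near (leaf (sibling m))) (stem-sibling m) (near-stem (sibling m))) (tree (stem-adj m))

  -- The two siblings, `x` and the common stem would form a square.
  ¬common-partner-sibling : ∀ {m x} → Partners L m x → ¬ Partners L x (sibling m)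
  ¬common-partner-sibling {m} {x} (partners mx) (partners near) = no-square {G} girth distinct (stem≢leaf m x ∘ sym) mx near
    (subst (Near (leaf (sibling m))) (stem-sibling m) (near-stem (sibling m))) (tree (stem-adj m))
    where
    distinct : at (leaf m) ≢ at (leaf (sibling m))
    distinct eq = sibling≢ m (sym (leaf-injective (at-injective eq)))

does⁻ : ∀ {P : Set} (p? : Dec P) → T (does p?) → P
does⁻ (yes p) _ = p

-- Colourings

Colour : Set
Colour = Fin 3

third : Colour → Colour → Colour
third 0F 1F = 2F
third 1F 0F = 2F
third 0F 2F = 1F
third 2F 0F = 1F
third 1F 2F = 0F
third 2F 1F = 0F
-- The diagonal values are arbitrary: the search applies `third` to distinct colours only.
third 0F 0F = 0F
third 1F 1F = 1F
third 2F 2F = 2F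

third-≢ : ∀ a b → a ≢ b → third a b ≢ a × third a b ≢ b
third-≢ = from-yes (all? λ a → all? λ b → ¬? (a ≟ b) →-dec (¬? (third a b ≟ a) ×-dec ¬? (third a b ≟ b)))

Edge : Set
Edge = Leaf × Leaf

Touches : Leaf → Edge → Set
Touches z (m , n) = z ≡ m ⊎ z ≡ n

-- The fourth coincidence of ends, `suc i ≡ suc j`, is left out because it forces `i ≡ j`.
Touch : Fin 21 → Fin 21 → Set
Touch i j = parent i ≡ parent j ⊎ suc i ≡ parent j ⊎ parent i ≡ suc j

-- The three edges at each inner vertex.
stars : List (Fin 21 × Fin 21 × Fin 21)
stars =
  (# 0 , # 1 , # 2) ∷ (# 0 , # 3 , # 4) ∷ (# 1 , # 5 , # 6) ∷ (# 2 , # 7 , # 8) ∷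
  (# 3 , # 9 , # 10) ∷ (# 4 , # 11 , # 12) ∷ (# 5 , # 13 , # 14) ∷
  (# 6 , # 15 , # 16) ∷ (# 7 , # 17 , # 18) ∷ (# 8 , # 19 , # 20) ∷ []

Rainbow : Vec Colour 21 → Fin 21 × Fin 21 × Fin 21 → Set
Rainbow t (i , j , k) = lookup t i ≢ lookup t j × lookup t i ≢ lookup t k × lookup t j ≢ lookup t k

ProperTree : Vec Colour 21 → Set
ProperTree t = All (Rainbow t) stars

properTree? : ∀ t → Dec (ProperTree t)
properTree? t = All.all? (λ (i , j , k) →
  ¬? (lookup t i ≟ lookup t j) ×-dec ¬? (lookup t i ≟ lookup t k) ×-dec ¬? (lookup t j ≟ lookup t k)) stars

_∈₃_ : Fin 21 → Fin 21 × Fin 21 × Fin 21 → Set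
e ∈₃ (i , j , k) = e ≡ i ⊎ e ≡ j ⊎ e ≡ k

abstract
  -- A leaf has a single tree edge, so distinct tree edges meet at an inner vertex; thus the ten
  -- stars decide whether a tree colouring is proper.
  touch⇒star : ∀ i j → Touch i j → Any (λ s → i ∈₃ s × j ∈₃ s) stars
  touch⇒star = from-yes (all? λ i → all? λ j →
    (parent i ≟ parent j ⊎-dec suc i ≟ parent j ⊎-dec parent i ≟ suc j) →-dec
    Any.any? (λ s → (i ∈₃? s) ×-dec (j ∈₃? s)) stars)
    where
    _∈₃?_ : ∀ e s → Dec (e ∈₃ s)
    e ∈₃? (i , j , k) = e ≟ i ⊎-dec e ≟ j ⊎-dec e ≟ k

properTree-touch : ∀ {t i j} → ProperTree t → i ≢ j → Touch i j → lookup t i ≢ lookup t j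
properTree-touch {t} {i} {j} proper i≢j touch = search proper (touch⇒star i j touch)
  where
  distinct : ∀ s → Rainbow t s → i ∈₃ s → j ∈₃ s → lookup t i ≢ lookup t j
  distinct _ _              (inj₁ refl)        (inj₁ refl)        = contradiction refl i≢j
  distinct _ (ij , _  , _)  (inj₁ refl)        (inj₂ (inj₁ refl)) = ij
  distinct _ (_  , ik , _)  (inj₁ refl)        (inj₂ (inj₂ refl)) = ik
  distinct _ (ij , _  , _)  (inj₂ (inj₁ refl)) (inj₁ refl)        = ij ∘ sym
  distinct _ _              (inj₂ (inj₁ refl)) (inj₂ (inj₁ refl)) = contradiction refl i≢j
  distinct _ (_  , _  , jk) (inj₂ (inj₁ refl)) (inj₂ (inj₂ refl)) = jk
  distinct _ (_  , ik , _)  (inj₂ (inj₂ refl)) (inj₁ refl)        = ik ∘ sym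
  distinct _ (_  , _  , jk) (inj₂ (inj₂ refl)) (inj₂ (inj₁ refl)) = jk ∘ sym
  distinct _ _              (inj₂ (inj₂ refl)) (inj₂ (inj₂ refl)) = contradiction refl i≢j

  search : ∀ {ss} → All (Rainbow t) ss → Any (λ s → i ∈₃ s × j ∈₃ s) ss → lookup t i ≢ lookup t j
  search (r ∷ _)  (here (p , q)) = distinct _ r p q
  search (_ ∷ rs) (there any)    = search rs any

-- Up to a permutation of the colours, the edges at the centre are coloured 0, 1, 2.
treeColourings : List (Vec Colour 9 × Vec Colour 12)
treeColourings =
  splits 0F λ m₁ m₂ → splits 1F λ m₃ m₄ → splits 2F λ m₅ m₆ →
  splits m₁ λ n₁ n₂ → splits m₂ λ n₃ n₄ → splits m₃ λ n₅ n₆ →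
  splits m₄ λ n₇ n₈ → splits m₅ λ n₉ n₁₀ → splits m₆ λ n₁₁ n₁₂ →
  (0F ∷ 1F ∷ 2F ∷ m₁ ∷ m₂ ∷ m₃ ∷ m₄ ∷ m₅ ∷ m₆ ∷ [] ,
   n₁ ∷ n₂ ∷ n₃ ∷ n₄ ∷ n₅ ∷ n₆ ∷ n₇ ∷ n₈ ∷ n₉ ∷ n₁₀ ∷ n₁₁ ∷ n₁₂ ∷ []) ∷ []
  where
  splits : ∀ {A : Set} → Colour → (Colour → Colour → List A) → List A
  splits 0F f = f 1F 2F ++ f 2F 1F
  splits 1F f = f 0F 2F ++ f 2F 0F
  splits 2F f = f 0F 1F ++ f 1F 0F

abstract
  treeColourings-proper : All (λ (u , l) → ProperTree (u Vec.++ l)) treeColourings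
  treeColourings-proper = from-yes (All.all? (λ (u , l) → properTree? (u Vec.++ l)) treeColourings)

-- The tree edges are split into the nine inner and the twelve pendant ones, so that
-- `lookup lower n` is the colour at leaf `n`; `entries` colours the edges between leaves.
record Colouring : Set where
  constructor colouring
  field
    upper   : Vec Colour 9
    lower   : Vec Colour 12
    entries : List (Edge × Colour)

-- A colouring along a cycle of leaves that is still to be closed: `current` is
-- the colour of the next edge, `closing` that of the last one.
record Pending : Set where
  constructor pending
  field
    upper   : Vec Colour 9
    lower   : Vec Colour 12
    closing : Colour
    current : Colour
    entries : List (Edge × Colour)

-- The only choice along a cycle: of the two colours not on the stem, one is reserved for the
-- closing edge and the other starts the path. From then on the stem of each leaf and the edge
-- leading to it force the colour of the next edge.
depart : Leaf → Colouring → List Pending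
depart s (colouring u l K) = go 0F ++ go 1F ++ go 2F
  where
  go : Colour → List Pending
  go k = if does (lookup l s ≟ k) then [] else pending u l k (third k (lookup l s)) K ∷ []

traverse : Leaf → Leaf → Pending → List Pending
traverse m n (pending u l k₀ k K) =
  if does (lookup l n ≟ k) then [] else pending u l k₀ (third k (lookup l n)) (((m , n) , k) ∷ K) ∷ []

finish : Leaf → Leaf → Pending → List Colouring
finish m s (pending u l k₀ k K) = if does (k₀ ≟ k) then colouring u l (((m , s) , k) ∷ K) ∷ [] else []

Untouched : Leaf → List Edge → Set
Untouched z = All (¬_ ∘ Touches z)

Differ : Edge × Colour → Edge × Colour → Set
Differ (e , k) (f , l) = ∀ {z} → Touches z e → Touches z f → k ≢ l

OffTree : Vec Colour 12 → Edge × Colour → Set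
OffTree l ((m , n) , k) = k ≢ lookup l m × k ≢ lookup l n

Avoids : Leaf → Colour → Edge × Colour → Set
Avoids z k (e , l) = Touches z e → l ≢ k

record Proper (E : List Edge) (u : Vec Colour 9) (l : Vec Colour 12) (K : List (Edge × Colour)) : Set where
  field
    tree     : ProperTree (u Vec.++ l)
    edges    : map proj₁ K ≡ E
    distinct : AllPairs Differ K
    off-tree : All (OffTree l) K

ProperColouring : List Edge → Colouring → Set
ProperColouring E (colouring u l K) = Proper E u l K

-- The closing edge is not yet among the entries, so its constraints are kept apart. `start-differs`
-- matters only before the first step, when the first and the last edge at `s` are both still open.
record ProperPending (E : List Edge) (s x : Leaf) (p : Pending) : Set where
  open Pending p
  field
    proper        : Proper E upper lower entries
    current-stem  : current ≢ lookup lower x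
    current-new   : All (Avoids x current) entries
    closing-stem  : closing ≢ lookup lower s
    closing-new   : All (Avoids s closing) entries
    start-differs : x ≡ s → current ≢ closing

untouched⇒avoids : ∀ {E K z} → map proj₁ K ≡ E → Untouched z E → ∀ k → All (Avoids z k) K
untouched⇒avoids refl untouched k = All.map (λ ¬t t → contradiction t ¬t) (All.map⁻ untouched)

depart-proper : ∀ {E s} c → Untouched s E → ProperColouring E c → All (ProperPending E s s) (depart s c)
depart-proper {E} {s} (colouring u l K) untouched proper = All.++⁺ (go 0F) (All.++⁺ (go 1F) (go 2F))
  where
  open Proper proper
  go : ∀ k → All (ProperPending E s s)
         (if does (lookup l s ≟ k) then [] else pending u l k (third k (lookup l s)) K ∷ [])
  go k with lookup l s ≟ k
  ... | yes _ = []
  ... | no ≢k = record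
    { proper        = proper
    ; current-stem  = proj₂ (third-≢ k (lookup l s) (≢k ∘ sym))
    ; current-new   = untouched⇒avoids edges untouched _
    ; closing-stem  = ≢k ∘ sym
    ; closing-new   = untouched⇒avoids edges untouched k
    ; start-differs = λ _ → proj₁ (third-≢ k (lookup l s) (≢k ∘ sym))
    } ∷ []

traverse-proper : ∀ {E s x n} p → Untouched n E → n ≢ s → n ≢ x → ProperPending E s x p →
                  All (ProperPending ((x , n) ∷ E) s n) (traverse x n p)
traverse-proper {E} {s} {x} {n} (pending u l k₀ k K) untouched n≢s n≢x p with lookup l n ≟ k
... | yes _ = []
... | no ≢k = record
  { proper        = record
    { tree     = tree
    ; edges    = cong ((x , n) ∷_) edges
    ; distinct = All.zipWith (λ (ax , an) → λ where
                   (inj₁ refl) t → ax t ∘ sym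
                   (inj₂ refl) t → an t ∘ sym) (current-new , untouched⇒avoids edges untouched k) ∷ distinct
    ; off-tree = (current-stem , ≢k ∘ sym) ∷ off-tree
    }
  ; current-stem  = proj₂ (third-≢ k (lookup l n) (≢k ∘ sym))
  ; current-new   = (λ _ → proj₁ (third-≢ k (lookup l n) (≢k ∘ sym)) ∘ sym) ∷ untouched⇒avoids edges untouched _
  ; closing-stem  = closing-stem
  ; closing-new   = (λ where
                      (inj₁ s≡x) → start-differs (sym s≡x)
                      (inj₂ s≡n) → contradiction (sym s≡n) n≢s) ∷ closing-new
  ; start-differs = λ n≡s → contradiction n≡s n≢s
  } ∷ []
  where
  open ProperPending p
  open Proper proper

finish-proper : ∀ {E s x} p → ProperPending E s x p → All (ProperColouring ((x , s) ∷ E)) (finish x s p)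
finish-proper {E} {s} {x} (pending u l k₀ k K) p with k₀ ≟ k
... | no _     = []
... | yes refl = record
  { tree     = tree
  ; edges    = cong ((x , s) ∷_) edges
  ; distinct = All.zipWith (λ (ax , as) → λ where
                 (inj₁ refl) t → ax t ∘ sym
                 (inj₂ refl) t → as t ∘ sym) (current-new , closing-new) ∷ distinct
  ; off-tree = (current-stem , closing-stem) ∷ off-tree
  } ∷ []
  where
  open ProperPending p
  open Proper proper

uncoloured : Vec Colour 9 × Vec Colour 12 → Colouring
uncoloured (u , l) = colouring u l []

initialColourings : List Colouring
initialColourings = map uncoloured treeColourings

uncoloured-proper : ∀ {ts} → All (λ (u , l) → ProperTree (u Vec.++ l)) ts →
                    All (ProperColouring []) (map uncoloured ts)
uncoloured-proper []            = []
uncoloured-proper (proper ∷ ps) =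
  record { tree = proper ; edges = refl ; distinct = [] ; off-tree = [] } ∷ uncoloured-proper ps

initialColourings-proper : All (ProperColouring []) initialColourings
initialColourings-proper = uncoloured-proper {treeColourings} treeColourings-proper

-- The search

remove : Leaf → List Leaf → List Leaf
remove n = filter λ z → ¬? (z ≟ n)

siblings : Leaf → Leaf → Bool
siblings m n = does (sibling m ≟ n)

-- A path of leaves from `start` over `second`, …, `antepenultimate`, `previous`
-- to `current`; on a path that is too short for them to be distinct, the
-- names refer to the start or overlap.
record Position : Set where
  constructor mkPosition
  field
    unvisited       : List Leaf
    stabiliser      : List Symmetry
    start           : Leaf
    second          : Leaf
    antepenultimate : Leaf
    previous        : Leaf
    current         : Leaf
    edges           : List Edge
    pendings        : List Pending

fixing : Leaf → List Symmetry → List Symmetry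
fixing n = filter λ σ → Symmetry.act σ n ≟ n

begin : List Leaf → List Symmetry → Leaf → List Edge → List Colouring → Position
begin U σs s E cs = mkPosition (remove s U) (fixing s σs) s s s s s E (concatMap (depart s) cs)

advance : Position → Leaf → Position
advance (mkPosition U σs s a q p x E ps) n =
  mkPosition (remove n U) (fixing n σs) s (if does (x ≟ s) then n else a) p x n ((x , n) ∷ E) (concatMap (traverse x n) ps)

-- The sibling of the current leaf would close a triangle, that of the previous one a square, both
-- through a stem. The last test keeps only candidates that no remaining exchange makes smaller.
excluded : Position → Leaf → Bool
excluded P n = siblings current n ∨ siblings previous n ∨
               any (λ σ → does (Symmetry.act σ n <? n)) stabiliser
  where open Position P

-- The first test catches a path with at most one edge. The next two are a triangle and a square of
-- leaves, the fourth a triangle through a stem, and the last two are squares through a stem.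
unclosable : Position → Bool
unclosable P = does (current ≟ second) ∨ does (previous ≟ second) ∨ does (antepenultimate ≟ second) ∨
               siblings current start ∨ siblings previous start ∨ siblings current second
  where open Position P

root : Position
root = begin (allFin 12) symmetries 0F [] initialColourings

module Search (accepted : List Edge → Bool) where

  explore  : ℕ → Position → Bool
  complete : ℕ → List Leaf → List Symmetry → List Edge → List Colouring → Bool

  -- Running out of depth counts as failure, so no bound on the depth has to be proved.
  explore zero    _ = false
  explore (suc d) P@(mkPosition U σs s a q p x E ps) =
    (unclosable P ∨ complete d U σs ((x , s) ∷ E) (concatMap (finish x s) ps)) ∧
    all (λ n → excluded P n ∨ explore d (advance P n)) U

  complete d []          _  E []      = accepted E
  -- A colouring that survives until every cycle is closed colours the whole graph, which is then no
  -- snark.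
  complete d []          _  _ (_ ∷ _) = true
  complete d U@(s ∷ _) σs E cs      = explore d (begin U σs s E cs)

-- Soundness of the search

Link : List Edge → Leaf → Leaf → Set
Link E m n = (m , n) ∈ E ⊎ (n , m) ∈ E

-- A leaf has only two partners, so all partners of a saturated leaf are recorded.
Saturated : List Edge → Leaf → Set
Saturated E n = ∃[ x ] ∃[ y ] x ≢ y × Link E n x × Link E n y

link-∷ : ∀ {E e m n} → Link E m n → Link (e ∷ E) m n
link-∷ = Sum.map there there

saturated-∷ : ∀ {E e n} → Saturated E n → Saturated (e ∷ E) n
saturated-∷ {E} (x , y , x≢y , nx , ny) = x , y , x≢y , link-∷ {E} nx , link-∷ {E} ny

AllPartners : ∀ {G} → Labelling G → List Edge → Set
AllPartners L = All λ (m , n) → Partners L m n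

link⇒partners : ∀ {G} (L : Labelling G) {E m n} → AllPartners L E → Link E m n → Partners L m n
link⇒partners L near (inj₁ e) = All.lookup near e
link⇒partners L near (inj₂ e) = partners-sym (All.lookup near e)

-- Whether a recorded edge set is consistent with a labelling is the only
-- property that depends on the labelling; the others survive a relabelling.
data Stage : Position → Set where
  at-start : ∀ {U σs s a q E ps} → Untouched s E → Stage (mkPosition U σs s a q s s E ps)
  moving   : ∀ {U σs s a q p x E ps} →
             (p , x) ∈ E → (s , a) ∈ E → x ≢ s → q ≡ p ⊎ (q , p) ∈ E →
             (∀ {e} → e ∈ E → Touches x e → e ≡ (p , x)) →
             Stage (mkPosition U σs s a q p x E ps)

Outside : List Leaf → Edge → Set
Outside U (m , n) = m ∉ U × n ∉ U

Fixes : List Leaf → Symmetry → Set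
Fixes U σ = ∀ n → n ∉ U → Symmetry.act σ n ≡ n

-- By `covered`, only the two ends of the open path may lack a partner among the visited leaves.
-- Hence a new partner of the current leaf is unvisited or the start.
record Consistent (P : Position) : Set where
  open Position P
  field
    stage     : Stage P
    start∉    : start ∉ unvisited
    previous∉ : previous ∉ unvisited
    current∉  : current ∉ unvisited
    edges∉    : All (Outside unvisited) edges
    covered   : ∀ n → n ∈ unvisited ⊎ n ≡ start ⊎ n ≡ current ⊎ Saturated edges n
    fixes     : All (Fixes unvisited) stabiliser
    pendings-proper : All (ProperPending edges start current) pendings

∈-remove⁻ : ∀ {z n} U → z ∈ remove n U → z ∈ U × z ≢ n
∈-remove⁻ {n = n} U = ∈-filter⁻ (λ z → ¬? (z ≟ n)) {xs = U}

∈-remove : ∀ {z} n {U} → z ∈ U → z ≡ n ⊎ z ∈ remove n U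
∈-remove {z} n z∈U with z ≟ n
... | yes z≡n = inj₁ z≡n
... | no  z≢n = inj₂ (∈-filter⁺ (λ z → ¬? (z ≟ n)) z∈U z≢n)

outside⇒untouched : ∀ {U E n} → n ∈ U → All (Outside U) E → Untouched n E
outside⇒untouched n∈U = All.map λ where
  (m∉ , _) (inj₁ refl) → m∉ n∈U
  (_ , n∉) (inj₂ refl) → n∉ n∈U

outside-remove : ∀ {U n E} → All (Outside U) E → All (Outside (remove n U)) E
outside-remove {U} = All.map (×.map (_∘ proj₁ ∘ ∈-remove⁻ U) (_∘ proj₁ ∘ ∈-remove⁻ U))

open DecMembership (_≟_ {12}) using () renaming (_∈?_ to _∈leaves?_)

fixes-fixing : ∀ {U σs} n → All (Fixes U) σs → All (Fixes (remove n U)) (fixing n σs)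
fixes-fixing {U} {σs} n fixes =
  All.zipWith (λ {σ} (fixes , fix-n) → go σ fixes fix-n)
    (All.filter⁺ (λ σ → Symmetry.act σ n ≟ n) fixes , All.all-filter (λ σ → Symmetry.act σ n ≟ n) σs)
  where
  go : ∀ σ → Fixes U σ → Symmetry.act σ n ≡ n → Fixes (remove n U) σ
  go σ fixes fix-n z z∉ with z ∈leaves? U
  ... | no z∉U = fixes z z∉U
  ... | yes z∈U with ∈-remove n z∈U
  ...   | inj₁ refl = fix-n
  ...   | inj₂ z∈   = contradiction z∈ z∉

begin-consistent : ∀ {U σs s E cs} → All (Outside U) E → Untouched s E →
  (∀ n → n ∈ U ⊎ n ≡ s ⊎ Saturated E n) → All (Fixes U) σs → All (ProperColouring E) cs →
  Consistent (begin U σs s E cs)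
begin-consistent {U} {σs} {s} {E} {cs} edges∉ untouched covered fixes proper = record
  { stage     = at-start untouched
  ; start∉    = s∉
  ; previous∉ = s∉
  ; current∉  = s∉
  ; edges∉    = outside-remove edges∉
  ; covered   = λ n → [ [ inj₂ ∘ inj₁ , inj₁ ]′ ∘ ∈-remove s , [ inj₂ ∘ inj₁ , inj₂ ∘ inj₂ ∘ inj₂ ]′ ]′ (covered n)
  ; fixes     = fixes-fixing {U} s fixes
  ; pendings-proper = All.concat⁺ (All.map⁺ (All.map (λ {c} → depart-proper c untouched) proper))
  }
  where
  s∉ : s ∉ remove s U
  s∉ s∈ = proj₂ (∈-remove⁻ U s∈) refl

advance-consistent : ∀ P n → Consistent P → n ∈ Position.unvisited P → n ≢ Position.previous P →
                     Consistent (advance P n)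
advance-consistent P@(mkPosition U σs s a q p x E ps) n c n∈U n≢p = record
  { stage     = stage′ stage
  ; start∉    = start∉ ∘ proj₁ ∘ ∈-remove⁻ U
  ; previous∉ = current∉ ∘ proj₁ ∘ ∈-remove⁻ U
  ; current∉  = n∉
  ; edges∉    = (current∉ ∘ proj₁ ∘ ∈-remove⁻ U , n∉) ∷ outside-remove edges∉
  ; covered   = covered′
  ; fixes     = fixes-fixing {U} n fixes
  ; pendings-proper = All.concat⁺ (All.map⁺ (All.map (λ {p} → traverse-proper p untouched n≢s n≢x) pendings-proper))
  }
  where
  open Consistent c

  untouched : Untouched n E
  untouched = outside⇒untouched n∈U edges∉

  n≢s : n ≢ s
  n≢s refl = start∉ n∈U

  n≢x : n ≢ x
  n≢x refl = current∉ n∈U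

  n∉ : n ∉ remove n U
  n∉ n∈ = proj₂ (∈-remove⁻ U n∈) refl

  only : ∀ {e} → e ∈ (x , n) ∷ E → Touches n e → e ≡ (x , n)
  only (here eq)  _ = eq
  only (there e∈) t = contradiction t (All.lookup untouched e∈)

  stage′ : Stage P → Stage (advance P n)
  stage′ (at-start _) with x ≟ x
  ... | yes _  = moving (here refl) (here refl) n≢s (inj₁ refl) only
  ... | no x≢x = contradiction refl x≢x
  stage′ (moving px sa x≢s _ _) with x ≟ s
  ... | yes x≡s = contradiction x≡s x≢s
  ... | no  _   = moving (here refl) (there sa) n≢s (inj₂ (there px)) only

  saturate : Stage P → x ≡ s ⊎ Saturated ((x , n) ∷ E) x
  saturate (at-start _)        = inj₁ refl
  saturate (moving px _ _ _ _) = inj₂ (p , n , n≢p ∘ sym , inj₂ (there px) , inj₁ (here refl))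

  covered′ : ∀ m → m ∈ remove n U ⊎ m ≡ s ⊎ m ≡ n ⊎ Saturated ((x , n) ∷ E) m
  covered′ m with covered m
  ... | inj₁ m∈U = [ inj₂ ∘ inj₂ ∘ inj₁ , inj₁ ]′ (∈-remove n m∈U)
  ... | inj₂ (inj₁ m≡s) = inj₂ (inj₁ m≡s)
  ... | inj₂ (inj₂ (inj₁ refl)) = inj₂ (Sum.map₂ inj₂ (saturate stage))
  ... | inj₂ (inj₂ (inj₂ sat)) = inj₂ (inj₂ (inj₂ (saturated-∷ sat)))

-- The closing edge gives each end of the path its second partner; the inequalities say that it
-- differs from the first.
close-covered : ∀ P → Consistent P → let open Position P in
  previous ≢ start → current ≢ start → current ≢ second →
  ∀ n → n ∈ unvisited ⊎ Saturated ((current , start) ∷ edges) n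
close-covered P@(mkPosition U σs s a q p x E ps) c p≢s x≢s x≢a n with Consistent.covered c n
... | inj₁ n∈U = inj₁ n∈U
... | inj₂ (inj₂ (inj₂ sat)) = inj₂ (saturated-∷ sat)
... | inj₂ (inj₁ refl) = inj₂ (from-stage (Consistent.stage c))
  where
  from-stage : Stage P → Saturated ((x , s) ∷ E) s
  from-stage (at-start _)        = contradiction refl x≢s
  from-stage (moving _ sa _ _ _) = a , x , x≢a ∘ sym , inj₁ (there sa) , inj₂ (here refl)
... | inj₂ (inj₂ (inj₁ refl)) = inj₂ (from-stage (Consistent.stage c))
  where
  from-stage : Stage P → Saturated ((x , s) ∷ E) x
  from-stage (at-start _)        = contradiction refl x≢s
  from-stage (moving px _ _ _ _) = p , s , p≢s , inj₂ (there px) , inj₁ (here refl)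

-- Both outcomes are demanded for every labelling, because the argument replaces the labelling on
-- its way down the search tree.
module Soundness {G : Graph} (cubic : Cubic G) (girth : GirthAtLeast G 5)
  (accepted : List Edge → Bool) {Result : Set}
  (accept : ∀ (L : Labelling G) E → AllPartners L E → T (accepted E) → Result)
  (colour : ∀ (L : Labelling G) E c → AllPartners L E → (∀ n → Saturated E n) → ProperColouring E c → Result)
  where

  open Search accepted
  open Labelling using (at; Near)
  open Partners using (near)

  ≢-at : ∀ (L : Labelling G) {m n : Leaf} → m ≢ n → at L (leaf m) ≢ at L (leaf n)
  ≢-at L m≢n eq = m≢n (leaf-injective (at-injective cubic girth L eq))

  second-≢ : ∀ (L : Labelling G) P → Stage P → let open Position P in
             Partners L current start → start ≢ previous → current ≢ second
  second-≢ L _ (at-start _)             xs _   = contradiction refl (partners-irrefl xs)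
  second-≢ L _ (moving _ sa _ _ only) xs s≢p refl = s≢p (cong proj₁ (only sa (inj₂ refl)))

  closable : ∀ (L : Labelling G) P → Stage P → AllPartners L (Position.edges P) → let open Position P in
             Partners L current start → start ≢ previous → ¬ T (unclosable P)
  closable L _ (at-start _) _ xs _ _ = contradiction refl (partners-irrefl xs)
  closable L P@(mkPosition U σs s a q p x E ps) stage@(moving px∈ sa∈ x≢s q∈ only) links xs s≢p =
    [ second-≢ L P stage xs s≢p ∘ does⁻ (x ≟ a) ,
    [ p≢a ∘ does⁻ (p ≟ a) ,
    [ q≢a q∈ ∘ does⁻ (q ≟ a) ,
    [ (λ t → ¬partner-sibling cubic girth L (subst (Partners L x) (sym (does⁻ (sibling x ≟ s) t)) xs)) ,
    [ (λ t → ¬common-partner-sibling cubic girth L px (subst (Partners L x) (sym (does⁻ (sibling p ≟ s) t)) xs)) ,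
      (λ t → ¬common-partner-sibling cubic girth L xs (subst (Partners L s) (sym (does⁻ (sibling x ≟ a) t)) sa))
    ]′ ∘ Equivalence.to T-∨ ]′ ∘ Equivalence.to T-∨ ]′ ∘ Equivalence.to T-∨ ]′ ∘ Equivalence.to T-∨ ]′ ∘ Equivalence.to T-∨
    where
    px : Partners L p x
    px = All.lookup links px∈

    sa : Partners L s a
    sa = All.lookup links sa∈

    p≢a : p ≢ a
    p≢a refl = no-triangle {G} girth (near sa) (near px) (near xs)

    q≢a : q ≡ p ⊎ (q , p) ∈ E → q ≢ a
    q≢a (inj₁ refl) = p≢a
    q≢a (inj₂ qp∈) refl = no-square {G} girth (≢-at L s≢p) (≢-at L q≢x) (near sa) (near (All.lookup links qp∈)) (near px) (near xs)
      where
      q≢x : q ≢ x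
      q≢x refl = partners-irrefl px (cong proj₂ (only qp∈ (inj₁ refl)))

  not-excluded-by-sibling : ∀ (L : Labelling G) P {n} → Stage P → AllPartners L (Position.edges P) →
    let open Position P in Partners L current n → ¬ T (siblings current n) × ¬ T (siblings previous n)
  not-excluded-by-sibling L P {n} stage near xn =
    (λ t → ¬partner-sibling cubic girth L (subst (Partners L current) (sym (does⁻ (sibling current ≟ n) t)) xn)) ,
    previous-case P stage near xn
    where
    open Position P
    previous-case : ∀ P → Stage P → AllPartners L (Position.edges P) →
      Partners L (Position.current P) n → ¬ T (siblings (Position.previous P) n)
    previous-case (mkPosition _ _ s _ _ _ _ _ _) (at-start _) near sn t =
      ¬partner-sibling cubic girth L (subst (Partners L s) (sym (does⁻ (sibling s ≟ n) t)) sn)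
    previous-case (mkPosition _ _ _ _ _ p x _ _) (moving px _ _ _ _) near xn t =
      ¬common-partner-sibling cubic girth L (All.lookup near px)
        (subst (Partners L x) (sym (does⁻ (sibling p ≟ n) t)) xn)

  fixed-edge : ∀ (L : Labelling G) {U} σ → Fixes U σ → ∀ {e} → Outside U e →
               Partners L (proj₁ e) (proj₂ e) → Partners (relabel L σ) (proj₁ e) (proj₂ e)
  fixed-edge L σ fixes {m , n} (m∉ , n∉) (partners near) = partners (subst₂ (Near L)
    (sym (trans (on-leaves m) (cong leaf (fixes m m∉)))) (sym (trans (on-leaves n) (cong leaf (fixes n n∉)))) near)
    where open Symmetry σ

  -- The current leaf has a partner other than the previous leaf. It is the start, which closes the
  -- cycle, or unvisited, which extends the path; any other leaf contradicts the invariant.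
  sound : ∀ d P → Consistent P → T (explore d P) → ∀ (L : Labelling G) → AllPartners L (Position.edges P) → Result

  -- Induction on `n`. If an exchange moves `n` to a smaller leaf, relabel by it: the position is
  -- unchanged since all visited leaves are fixed, while the partner of the current leaf is now the
  -- smaller one.
  sound-extend : ∀ d P → Consistent P → let open Position P in
    T (all (λ n → excluded P n ∨ explore d (advance P n)) unvisited) →
    ∀ n → Acc Fin._<_ n → n ∈ unvisited → n ≢ previous →
    ∀ (L : Labelling G) → AllPartners L edges → Partners L current n → Result

  sound-complete : ∀ d U σs E cs → (∀ n → n ∈ U ⊎ Saturated E n) → All (Outside U) E → All (Fixes U) σs →
    All (ProperColouring E) cs → T (complete d U σs E cs) → ∀ (L : Labelling G) → AllPartners L E → Result

  sound (suc d) P@(mkPosition U σs s a q p x E ps) c t L near =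
    cases (partner-avoiding cubic girth L x p)
    where
    open Consistent c
    t′ = Equivalence.to T-∧ t

    close : Partners L x s → s ≢ p → Result
    close xs s≢p = [ (λ u → contradiction u (closable L P stage near xs s≢p)) ,
      (λ u → sound-complete d U σs ((x , s) ∷ E) (concatMap (finish x s) ps)
        (close-covered P c (s≢p ∘ sym) (partners-irrefl xs) (second-≢ L P stage xs s≢p))
        ((current∉ , start∉) ∷ edges∉) fixes
        (All.concat⁺ (All.map⁺ (All.map (λ {p} → finish-proper p) pendings-proper)))
        u L (xs ∷ near)) ]′ (Equivalence.to T-∨ (proj₁ t′))

    -- A saturated `n` has `x` among its recorded partners, but no edge is recorded at `x`
    -- initially, and later only the one to `p`.
    old : ∀ {n} → Partners L x n → n ≢ p → Link E n x → Stage P → Result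
    old _ _   (inj₁ nx) (at-start u) = contradiction (inj₂ refl) (All.lookup u nx)
    old _ _   (inj₂ xn) (at-start u) = contradiction (inj₁ refl) (All.lookup u xn)
    old _ n≢p (inj₁ nx) (moving _ _ _ _ only) = contradiction (cong proj₁ (only nx (inj₂ refl))) n≢p
    old near-xn _ (inj₂ xn) (moving _ _ _ _ only) =
      contradiction (sym (cong proj₂ (only xn (inj₁ refl)))) (partners-irrefl near-xn)

    cases : ∃[ n ] Partners L x n × n ≢ p → Result
    cases (n , xn , n≢p) with covered n
    ... | inj₁ n∈U = sound-extend d P c (proj₂ t′) n (<-wellFounded n) n∈U n≢p L near xn
    ... | inj₂ (inj₁ refl) = close xn n≢p
    ... | inj₂ (inj₂ (inj₁ refl)) = contradiction refl (partners-irrefl xn)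
    ... | inj₂ (inj₂ (inj₂ (y , z , y≢z , ny , nz))) =
      [ (λ { refl → old xn n≢p ny stage }) , (λ { refl → old xn n≢p nz stage }) ]′
      (partner-exhaustive cubic girth L y≢z (link⇒partners L near ny) (link⇒partners L near nz) (partners-sym xn))

  sound-extend d P c t n (acc smaller) n∈U n≢p L links xn =
    [ [ (λ u → contradiction u (proj₁ no-sibling)) ,
      [ (λ u → contradiction u (proj₂ no-sibling)) ,
        (λ u → let σ , σ∈ , lt = find (Any.any⁻ (λ σ → does (Symmetry.act σ n <? n)) stabiliser u) in
               relabelled σ (All.lookup fixes σ∈) (does⁻ (Symmetry.act σ n <? n) lt)) ]′
      ∘ Equivalence.to T-∨ ]′ ∘ Equivalence.to T-∨ ,
      (λ u → sound d (advance P n) (advance-consistent P n c n∈U n≢p) u L (xn ∷ links)) ]′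
    (Equivalence.to T-∨ (All.lookup (All.all⁺ _ unvisited t) n∈U))
    where
    open Position P
    open Consistent c

    no-sibling = not-excluded-by-sibling L P stage links xn

    relabelled : ∀ σ → Fixes unvisited σ → Symmetry.act σ n Fin.< n → Result
    relabelled σ fix lt = sound-extend d P c t (act n) (smaller lt) σn∈U σn≢p (relabel L σ)
      (All.zipWith (λ {e} (o , k) → fixed-edge L σ fix {e} o k) (edges∉ , links))
      (partners (subst₂ (Near L)
        (sym (trans (on-leaves current) (cong leaf (fix current current∉))))
        -- Since `σ` is an involution, the leaf called `act n` in the new labelling is the one
        -- called `n` in the old.
        (sym (trans (on-leaves (act n)) (cong leaf (act-involutive n)))) (near xn)))
      where
      open Symmetry σ

      -- If `act n` were a visited leaf `z`, which `σ` fixes, then applying `σ` again would give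
      -- `n ≡ z`.
      moved : ∀ {z} → z ∉ unvisited → act n ≢ z
      moved {z} z∉ eq = z∉ (subst (_∈ unvisited) (trans (sym (act-involutive n)) (trans (cong act eq) (fix z z∉))) n∈U)

      σn∈U : act n ∈ unvisited
      σn∈U with act n ∈leaves? unvisited
      ... | yes σn∈ = σn∈
      ... | no  σn∉ = contradiction refl (moved σn∉)

      σn≢p : act n ≢ previous
      σn≢p = moved previous∉

  sound-complete d [] σs E [] covered edges∉ fixes _ t L near = accept L E near t
  sound-complete d [] σs E (c ∷ _) covered edges∉ fixes (proper ∷ _) t L near =
    colour L E c near (λ n → [ (λ ()) , id ]′ (covered n)) proper
  sound-complete d U@(s ∷ _) σs E cs covered edges∉ fixes proper t L near =
    sound d (begin U σs s E cs)
      (begin-consistent edges∉ (outside⇒untouched (here refl) edges∉) (λ n → Sum.map₂ inj₂ (covered n)) fixes proper)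
      t L near

  root-consistent : Consistent root
  root-consistent = begin-consistent [] [] (λ n → inj₁ (∈-allFin n))
    (All.universal (λ σ n n∉ → contradiction (∈-allFin n) n∉) symmetries) initialColourings-proper

  search-sound : ∀ d → explore d root ≡ true → Labelling G → Result
  search-sound d eq L = sound d root root-consistent (Equivalence.from T-≡ eq) L []

-- From a completed colouring in the search to a 3-edge-colouring of the graph

allPairs-lookup : ∀ {A : Set} {R : A → A → Set} {xs x y} → (∀ {x y} → R x y → R y x) →
                  AllPairs R xs → x ∈ xs → y ∈ xs → x ≡ y ⊎ R x y
allPairs-lookup sym-R (_ ∷ _)  (here refl) (here refl) = inj₁ refl
allPairs-lookup sym-R (r ∷ _)  (here refl) (there y∈)  = inj₂ (All.lookup r y∈)
allPairs-lookup sym-R (r ∷ _)  (there x∈)  (here refl) = inj₂ (sym-R (All.lookup r x∈))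
allPairs-lookup sym-R (_ ∷ rs) (there x∈)  (there y∈)  = allPairs-lookup sym-R rs x∈ y∈

differ-sym : ∀ {x y} → Differ x y → Differ y x
differ-sym d t t′ = d t′ t ∘ sym

module _ {G : Graph} (cubic : Cubic G) (girth : GirthAtLeast G 5) (L : Labelling G)
  {E : List Edge} {u : Vec Colour 9} {l : Vec Colour 12} {K : List (Edge × Colour)}
  (links : AllPartners L E) (saturated : ∀ n → Saturated E n) (proper : Proper E u l K) where

  open Labelling L using (vertices; at; of; at-of; of-at; Near)
  open Proper proper

  private
    t : Vec Colour 21
    t = u Vec.++ l

  data Source : Fin 22 → Fin 22 → Colour → Set where
    branch : ∀ i → Source (parent i) (suc i) (lookup t i)
    chord  : ∀ {m n k} → ((m , n) , k) ∈ K → Source (leaf m) (leaf n) k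

  Ends : Fin 22 → Fin 22 → Fin 22 → Fin 22 → Set
  Ends x y a b = (x ≡ a × y ≡ b) ⊎ (x ≡ b × y ≡ a)

  -- An edge outside the tree joins two leaves. As leaves are saturated, it is one of the recorded
  -- edges and so has a coloured entry.
  source : ∀ {x y} → Near x y → ∃[ a ] ∃[ b ] ∃[ k ] Source a b k × Ends x y a b
  source {x} {y} near = [ from-tree , from-chord ]′ (near-cases cubic girth L near)
    where
    from-tree : Adj T₃ x y → ∃[ a ] ∃[ b ] ∃[ k ] Source a b k × Ends x y a b
    from-tree (i , inj₁ eq) = _ , _ , _ , branch i , inj₁ (sym (cong proj₁ eq) , sym (cong proj₂ eq))
    from-tree (i , inj₂ eq) = _ , _ , _ , branch i , inj₂ (sym (cong proj₂ eq) , sym (cong proj₁ eq))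

    entry : ∀ {e} → e ∈ E → ∃[ k ] (e , k) ∈ K
    entry {e} e∈ with (_ , k) , k∈ , refl ← ∈-map⁻ proj₁ (subst (e ∈_) (sym edges) e∈) = k , k∈

    linked : ∀ {m n} → Link E m n → ∃[ a ] ∃[ b ] ∃[ k ] Source a b k × Ends (leaf m) (leaf n) a b
    linked (inj₁ mn) = _ , _ , _ , chord (proj₂ (entry mn)) , inj₁ (refl , refl)
    linked (inj₂ nm) = _ , _ , _ , chord (proj₂ (entry nm)) , inj₂ (refl , refl)

    from-chord : ∃[ m ] ∃[ n ] x ≡ leaf m × y ≡ leaf n → ∃[ a ] ∃[ b ] ∃[ k ] Source a b k × Ends x y a b
    from-chord (m , n , refl , refl) = let p , q , p≢q , mp , mq = saturated m in
      [ (λ { refl → linked mp }) , (λ { refl → linked mq }) ]′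
      (partner-exhaustive cubic girth L p≢q (link⇒partners L links mp) (link⇒partners L links mq) (partners near))

  On : Fin 22 → Fin 22 → Fin 22 → Set
  On z a b = z ≡ a ⊎ z ≡ b

  branches-distinct : ∀ {i j z} → i ≢ j → On z (parent i) (suc i) → On z (parent j) (suc j) →
                      lookup t i ≢ lookup t j
  branches-distinct {i} {j} i≢j p q = properTree-touch {t} tree i≢j (touch p q)
    where
    touch : ∀ {z} → On z (parent i) (suc i) → On z (parent j) (suc j) → Touch i j
    touch (inj₁ p) (inj₁ q) = inj₁ (trans (sym p) q)
    touch (inj₁ p) (inj₂ q) = inj₂ (inj₂ (trans (sym p) q))
    touch (inj₂ p) (inj₁ q) = inj₂ (inj₁ (trans (sym p) q))
    touch (inj₂ p) (inj₂ q) = contradiction (suc-injective (trans (sym p) q)) i≢j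

  leaf-branch : ∀ {i m} → On (leaf m) (parent i) (suc i) → lookup t i ≡ lookup l m
  leaf-branch {i} {m} (inj₁ eq) = contradiction (sym eq) (parent≢leaf i m)
  leaf-branch {i} {m} (inj₂ eq) = trans (cong (lookup t) (sym (suc-injective eq))) (lookup-++ʳ u l m)

  branch-chord : ∀ {i m n k z} → ((m , n) , k) ∈ K → On z (parent i) (suc i) → On z (leaf m) (leaf n) →
                 lookup t i ≢ k
  branch-chord {i} k∈ on (inj₁ refl) eq = proj₁ (All.lookup off-tree k∈) (trans (sym eq) (leaf-branch {i} on))
  branch-chord {i} k∈ on (inj₂ refl) eq = proj₂ (All.lookup off-tree k∈) (trans (sym eq) (leaf-branch {i} on))

  touches : ∀ {m n w} → On (leaf w) (leaf m) (leaf n) → Touches w (m , n)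
  touches = Sum.map leaf-injective leaf-injective

  chords-distinct : ∀ {m n m′ n′ k z} → ((m , n) , k) ∈ K → ((m′ , n′) , k) ∈ K →
                    On z (leaf m) (leaf n) → On z (leaf m′) (leaf n′) → leaf m ≡ leaf m′ × leaf n ≡ leaf n′
  chords-distinct {m} {n} {m′} {n′} {k} k∈ k′∈ on on′ = same (allPairs-lookup (λ {x} {y} → differ-sym {x} {y}) distinct k∈ k′∈) on on′
    where
    same : ∀ {z} → ((m , n) , k) ≡ ((m′ , n′) , k) ⊎ Differ ((m , n) , k) ((m′ , n′) , k) →
           On z (leaf m) (leaf n) → On z (leaf m′) (leaf n′) → leaf m ≡ leaf m′ × leaf n ≡ leaf n′
    same (inj₁ refl) _ _ = refl , refl
    same (inj₂ d) (inj₁ refl) on′ = contradiction refl (d (inj₁ refl) (touches on′))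
    same (inj₂ d) (inj₂ refl) on′ = contradiction refl (d (inj₂ refl) (touches on′))

  -- This is properness in contrapositive form: sources of equal colour with a common vertex
  -- coincide. Tree edges are compared through the stars, a chord and a tree edge through
  -- `off-tree`, and two chords through `distinct`.
  source-unique : ∀ {a b c d k k′ z} → Source a b k → Source c d k′ → On z a b → On z c d → k ≡ k′ →
                  a ≡ c × b ≡ d
  source-unique (branch i) (branch j) p q eq with i ≟ j
  ... | yes refl = refl , refl
  ... | no i≢j   = contradiction eq (branches-distinct i≢j p q)
  source-unique (branch i) (chord k∈) p q eq = contradiction eq (branch-chord {i} k∈ p q)
  source-unique (chord k∈) (branch j) p q eq = contradiction (sym eq) (branch-chord {j} k∈ q p)
  source-unique (chord k∈) (chord k′∈) p q refl = chords-distinct k∈ k′∈ p q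

  open Graph G using (V; ends; Incident)

  edge-source : ∀ e → ∃[ a ] ∃[ b ] ∃[ k ] Source a b k × Ends (of (proj₁ (ends e))) (of (proj₂ (ends e))) a b
  edge-source e = source (subst₂ (Adj G) (sym (at-of _)) (sym (at-of _)) (e , inj₁ refl))

  -- Each edge takes the colour of its source. Two edges of equal colour at a vertex have the same
  -- source, hence the same ends, and `G` is simple.
  properColouring⇒edgeColoring : EdgeColoring G 3
  properColouring⇒edgeColoring = colour , colour-proper
    where
    colour : Graph.E G → Colour
    colour e = let _ , _ , k , _ = edge-source e in k

    of-injective : ∀ {v w} → of v ≡ of w → v ≡ w
    of-injective = ↔-injective (↔-sym vertices)

    on : ∀ {v e a b} → Incident v e → Ends (of (proj₁ (ends e))) (of (proj₂ (ends e))) a b → On (of v) a b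
    on (inj₁ refl) (inj₁ (p , _)) = inj₁ p
    on (inj₁ refl) (inj₂ (p , _)) = inj₂ p
    on (inj₂ refl) (inj₁ (_ , q)) = inj₂ q
    on (inj₂ refl) (inj₂ (_ , q)) = inj₁ q

    same-ends : ∀ {x y x′ y′ a b} → Ends (of x) (of y) a b → Ends (of x′) (of y′) a b →
                (x ≡ x′ × y ≡ y′) ⊎ (x ≡ y′ × y ≡ x′)
    same-ends (inj₁ (p , q)) (inj₁ (p′ , q′)) = inj₁ (of-injective (trans p (sym p′)) , of-injective (trans q (sym q′)))
    same-ends (inj₁ (p , q)) (inj₂ (p′ , q′)) = inj₂ (of-injective (trans p (sym q′)) , of-injective (trans q (sym p′)))
    same-ends (inj₂ (p , q)) (inj₁ (p′ , q′)) = inj₂ (of-injective (trans p (sym q′)) , of-injective (trans q (sym p′)))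
    same-ends (inj₂ (p , q)) (inj₂ (p′ , q′)) = inj₁ (of-injective (trans p (sym p′)) , of-injective (trans q (sym q′)))

    colour-proper : ∀ e f v → e ≢ f → Incident v e → Incident v f → colour e ≢ colour f
    colour-proper e f v e≢f ve vf eq =
      let _ , _ , _ , s , p = edge-source e
          _ , _ , _ , s′ , p′ = edge-source f
          a≡c , b≡d = source-unique s s′ (on ve p) (on vf p′) eq
      in e≢f (simple⇒≡ {G} (girth⇒simple {G} girth) (inj₁ refl) (inj₁ refl)
           (same-ends p (subst₂ (Ends _ _) (sym a≡c) (sym b≡d) p′)))

-- The six graphs that the search arrives at

pattern 10F = suc 9F
pattern 11F = suc 10F

-- The three snarks, followed by the graphs with a small cyclic cut. Each is
-- given by a permutation of the leaves whose cycles are the cycles of leaves.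
successors : Vec (Vec Leaf 12) 6
successors =
  (2F ∷ 3F ∷ 4F ∷ 6F ∷ 1F ∷ 9F ∷ 8F ∷ 0F ∷ 10F ∷ 11F ∷ 5F ∷ 7F ∷ []) ∷
  (2F ∷ 3F ∷ 4F ∷ 9F ∷ 6F ∷ 7F ∷ 8F ∷ 1F ∷ 10F ∷ 11F ∷ 0F ∷ 5F ∷ []) ∷
  (2F ∷ 7F ∷ 4F ∷ 1F ∷ 6F ∷ 11F ∷ 8F ∷ 5F ∷ 10F ∷ 0F ∷ 3F ∷ 9F ∷ []) ∷
  (2F ∷ 3F ∷ 4F ∷ 5F ∷ 1F ∷ 0F ∷ 8F ∷ 9F ∷ 10F ∷ 11F ∷ 7F ∷ 6F ∷ []) ∷
  (2F ∷ 3F ∷ 4F ∷ 6F ∷ 1F ∷ 8F ∷ 0F ∷ 9F ∷ 10F ∷ 11F ∷ 7F ∷ 5F ∷ []) ∷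
  (2F ∷ 3F ∷ 4F ∷ 8F ∷ 1F ∷ 6F ∷ 10F ∷ 11F ∷ 0F ∷ 7F ∷ 9F ∷ 5F ∷ []) ∷
  []

chordEnds : Fin 6 → Leaf → Fin 22 × Fin 22
chordEnds k n = leaf n , leaf (lookup (lookup successors k) n)

graphEnds : Fin 6 → Fin 33 → Fin 22 × Fin 22
graphEnds k e = [ (λ i → parent i , suc i) , chordEnds k ]′ (splitAt 21 e)

abstract
  graph-loopless : ∀ k e → proj₁ (graphEnds k e) ≢ proj₂ (graphEnds k e)
  graph-loopless = from-yes (all? λ k → all? λ e → ¬? (proj₁ (graphEnds k e) ≟ proj₂ (graphEnds k e)))

graph : Fin 6 → Graph
graph k = record { order = 22 ; size = 33 ; ends = graphEnds k ; loopless = graph-loopless k }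

abstract
  graph-cubic : ∀ k → Cubic (graph k)
  graph-cubic = from-yes (all? λ k → all? λ v → Graph.degree (graph k) v ℕ.≟ 3)

-- Short cycles

-- Reading the neighbours off a table, which is passed as an argument, keeps
-- them from being computed again and again.
module _ {n : ℕ} (N : Vec (List (Fin n)) n) where
  open DecMembership (_≟_ {n}) using (_∈?_)

  -- On a walk `v`, `a`, `b` that does not turn back, an edge from `b` to `v` closes a triangle;
  -- after one more step to `c ≢ a`, an edge from `c` to `v` closes a square.
  NoShortCycles : Set
  NoShortCycles = ∀ v → All (λ a → All (λ b → b ≡ v ⊎
    (v ∉ lookup N b × All (λ c → c ≡ a ⊎ v ∉ lookup N c) (lookup N b)))
    (lookup N a)) (lookup N v)

  noShortCycles? : Dec NoShortCycles
  noShortCycles? = all? λ v → All.all? (λ a → All.all? (λ b → b ≟ v ⊎-dec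
    (¬? (v ∈? lookup N b) ×-dec All.all? (λ c → c ≟ a ⊎-dec ¬? (v ∈? lookup N c)) (lookup N b)))
    (lookup N a)) (lookup N v)

module _ (G : Graph) where
  open Graph G using (V; E; ends; Joins; incident?)

  other : V → E → V
  other v e = if does (v ≟ proj₁ (ends e)) then proj₂ (ends e) else proj₁ (ends e)

  neighbours : V → List V
  neighbours v = map (other v) (incidence {G} v)

  other-joins : ∀ {e v w} → Joins e v w → other v e ≡ w
  other-joins {e} {v} (inj₁ eq) with v ≟ proj₁ (ends e)
  ... | yes _ = cong proj₂ eq
  ... | no ≢  = contradiction (sym (cong proj₁ eq)) ≢
  other-joins {e} {v} (inj₂ eq) with v ≟ proj₁ (ends e)
  ... | yes v≡ = trans (cong proj₂ eq) (trans v≡ (cong proj₁ eq))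
  ... | no _   = cong proj₁ eq

  ∈-neighbours : ∀ {v w} → Adj G v w → w ∈ neighbours v
  ∈-neighbours {v} (e , j) = subst (_∈ neighbours v) (other-joins j) (∈-map⁺ (other v) (joins⇒∈ {G} j))

  neighbours-adj : ∀ {v w} → w ∈ neighbours v → Adj G v w
  neighbours-adj {v} {w} w∈ = let e , e∈ , eq = ∈-map⁻ (other v) w∈
                                  u , j = incident⇒joins {G} (proj₂ (∈-filter⁻ (incident? v) {xs = allFin (size G)} e∈))
                              in e , subst (Joins e v) (trans (sym (other-joins j)) (sym eq)) j

  neighbourTable : Vec (List V) (order G)
  neighbourTable = tabulate neighbours

  ∈-neighbourTable : ∀ {v w} → Adj G v w → w ∈ lookup neighbourTable v
  ∈-neighbourTable {v} {w} adj = subst (w ∈_) (sym (lookup∘tabulate neighbours v)) (∈-neighbours adj)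

  neighbourTable-adj : ∀ {v w} → w ∈ lookup neighbourTable v → Adj G v w
  neighbourTable-adj {v} {w} w∈ = neighbours-adj (subst (w ∈_) (lookup∘tabulate neighbours v) w∈)

  NoParallels : Set
  NoParallels = ∀ e f → (ends e ≡ ends f) ⊎ (ends e ≡ ×.swap (ends f)) → e ≡ f

  noParallels? : Dec NoParallels
  noParallels? = all? λ e → all? λ f →
    (≡-dec _≟_ _≟_ (ends e) (ends f) ⊎-dec ≡-dec _≟_ _≟_ (ends e) (×.swap (ends f))) →-dec (e ≟ f)

  noParallels⇒simple : NoParallels → Simple G
  noParallels⇒simple np {e} {f} (inj₁ p) (inj₁ q) = np e f (inj₁ (trans p (sym q)))
  noParallels⇒simple np {e} {f} (inj₁ p) (inj₂ q) = np e f (inj₂ (trans p (cong ×.swap (sym q))))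
  noParallels⇒simple np {e} {f} (inj₂ p) (inj₁ q) = np e f (inj₂ (trans p (cong ×.swap (sym q))))
  noParallels⇒simple np {e} {f} (inj₂ p) (inj₂ q) = np e f (inj₁ (trans p (sym q)))

  noShortCycles⇒girth≥5 : Simple G → NoShortCycles neighbourTable → GirthAtLeast G 5
  noShortCycles⇒girth≥5 simple ns 1 C = contradiction (_ , Cycle.joins C zero) (adj-irrefl {G})
  noShortCycles⇒girth≥5 simple ns 2 C =
    contradiction (Cycle.edge-injective C {0F} {1F} (simple (Cycle.joins C 0F) (swap (Cycle.joins C 1F)))) λ ()
  noShortCycles⇒girth≥5 simple ns 3 C = contradiction triangle λ
    { (inj₁ eq) → contradiction (Cycle.vertex-injective C eq) λ ()
    ; (inj₂ (∉ , _)) → ∉ (∈-neighbourTable (_ , Cycle.joins C 2F)) }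
    where
    triangle = All.lookup (All.lookup (ns (Cycle.vertex C 0F)) (∈-neighbourTable (_ , Cycle.joins C 0F)))
                 (∈-neighbourTable (_ , Cycle.joins C 1F))
  noShortCycles⇒girth≥5 simple ns 4 C = contradiction path λ
    { (inj₁ eq) → contradiction (Cycle.vertex-injective C eq) λ ()
    ; (inj₂ (_ , all)) → contradiction (All.lookup all (∈-neighbourTable (_ , Cycle.joins C 2F))) λ
        { (inj₁ eq) → contradiction (Cycle.vertex-injective C eq) λ ()
        ; (inj₂ ∉) → ∉ (∈-neighbourTable (_ , Cycle.joins C 3F)) } }
    where
    path = All.lookup (All.lookup (ns (Cycle.vertex C 0F)) (∈-neighbourTable (_ , Cycle.joins C 0F)))
             (∈-neighbourTable (_ , Cycle.joins C 1F))
  noShortCycles⇒girth≥5 simple ns (suc (suc (suc (suc (suc k))))) C = s≤s (s≤s (s≤s (s≤s (s≤s z≤n))))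

abstract
  graph-noParallels : ∀ k → NoParallels (graph k)
  graph-noParallels = from-yes (all? λ k → noParallels? (graph k))

graph-simple : ∀ k → Simple (graph k)
graph-simple k = noParallels⇒simple (graph k) (graph-noParallels k)

-- Recognising the six graphs

HasChord : List Edge → Fin 22 → Fin 22 → Set
HasChord E x y = Any (λ (m , n) → (x ≡ leaf m × y ≡ leaf n) ⊎ (x ≡ leaf n × y ≡ leaf m)) E

Present : List Edge → Fin 22 → Fin 22 → Set
Present E x y = HasChord E x y ⊎ Adj T₃ x y

present? : ∀ E x y → Dec (Present E x y)
present? E x y =
  Any.any? (λ (m , n) → (x ≟ leaf m ×-dec y ≟ leaf n) ⊎-dec (x ≟ leaf n ×-dec y ≟ leaf m)) E ⊎-dec adj? T₃ x y

present⇒near : ∀ {G} (L : Labelling G) {E x y} → AllPartners L E → Present E x y → Labelling.Near L x y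
present⇒near {G} L {x = x} {y} links = [ from-chord links , Labelling.tree L ]′
  where
  from-chord : ∀ {E} → AllPartners L E → HasChord E x y → Labelling.Near L x y
  from-chord (partners near ∷ _) (here (inj₁ (refl , refl))) = near
  from-chord (partners near ∷ _) (here (inj₂ (refl , refl))) = adj-sym {G} near
  from-chord (_ ∷ links)         (there any)                 = from-chord links any

-- A vertex map from one of the six graphs.
Certificate : Set
Certificate = Fin 6 × Vec (Fin 22) 22

-- Edges have to be preserved in one direction only; `cubic-embedding⇒≅` supplies the other. The
-- witnesses of surjectivity serve as the inverse map.
Certifies : List Edge → Certificate → Set
Certifies E (k , π) =
  (∀ n → Present E (lookup π (proj₁ (chordEnds k n))) (lookup π (proj₂ (chordEnds k n)))) ×
  (∀ i → Present E (lookup π (parent i)) (lookup π (suc i))) ×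
  (∀ w → ∃[ v ] lookup π v ≡ w) ×
  (∀ v w → lookup π v ≡ lookup π w → v ≡ w)

certifies? : ∀ E c → Dec (Certifies E c)
certifies? E (k , π) =
  all? (λ n → present? E (lookup π (proj₁ (chordEnds k n))) (lookup π (proj₂ (chordEnds k n)))) ×-dec
  all? (λ i → present? E (lookup π (parent i)) (lookup π (suc i))) ×-dec
  all? (λ w → any? λ v → lookup π v ≟ w) ×-dec
  all? (λ v → all? λ w → (lookup π v ≟ lookup π w) →-dec (v ≟ w))

-- A map that moves the centre 0 carries the tree of the model to a spanning `T₃` other than the
-- labelled one: the same graph may be reached through several spanning trees.
certificates : List Certificate
certificates = map (×.map₂ (Vec.map (_mod 22))) (
  (3F , 0 ∷ 1 ∷ 2 ∷ 3 ∷ 4 ∷ 5 ∷ 6 ∷ 7 ∷ 8 ∷ 9 ∷ 10 ∷ 11 ∷ 12 ∷ 13 ∷ 14 ∷ 15 ∷ 16 ∷ 17 ∷ 18 ∷ 19 ∷ 20 ∷ 21 ∷ []) ∷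
  (4F , 0 ∷ 1 ∷ 2 ∷ 3 ∷ 4 ∷ 5 ∷ 6 ∷ 7 ∷ 8 ∷ 9 ∷ 10 ∷ 11 ∷ 12 ∷ 13 ∷ 14 ∷ 15 ∷ 16 ∷ 17 ∷ 18 ∷ 19 ∷ 20 ∷ 21 ∷ []) ∷
  (0F , 0 ∷ 1 ∷ 2 ∷ 3 ∷ 4 ∷ 5 ∷ 6 ∷ 7 ∷ 8 ∷ 9 ∷ 10 ∷ 11 ∷ 12 ∷ 13 ∷ 14 ∷ 15 ∷ 16 ∷ 17 ∷ 18 ∷ 19 ∷ 20 ∷ 21 ∷ []) ∷
  (5F , 0 ∷ 1 ∷ 2 ∷ 3 ∷ 4 ∷ 5 ∷ 6 ∷ 7 ∷ 8 ∷ 9 ∷ 10 ∷ 11 ∷ 12 ∷ 13 ∷ 14 ∷ 15 ∷ 16 ∷ 17 ∷ 18 ∷ 19 ∷ 20 ∷ 21 ∷ []) ∷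
  (5F , 0 ∷ 1 ∷ 2 ∷ 3 ∷ 4 ∷ 5 ∷ 6 ∷ 7 ∷ 8 ∷ 9 ∷ 10 ∷ 11 ∷ 12 ∷ 13 ∷ 14 ∷ 15 ∷ 17 ∷ 16 ∷ 18 ∷ 19 ∷ 21 ∷ 20 ∷ []) ∷
  (5F , 0 ∷ 3 ∷ 1 ∷ 2 ∷ 8 ∷ 9 ∷ 5 ∷ 4 ∷ 7 ∷ 6 ∷ 19 ∷ 18 ∷ 21 ∷ 20 ∷ 13 ∷ 12 ∷ 10 ∷ 11 ∷ 17 ∷ 16 ∷ 15 ∷ 14 ∷ []) ∷
  (5F , 0 ∷ 3 ∷ 1 ∷ 2 ∷ 8 ∷ 9 ∷ 4 ∷ 5 ∷ 7 ∷ 6 ∷ 19 ∷ 18 ∷ 21 ∷ 20 ∷ 11 ∷ 10 ∷ 12 ∷ 13 ∷ 17 ∷ 16 ∷ 14 ∷ 15 ∷ []) ∷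
  (1F , 0 ∷ 1 ∷ 2 ∷ 3 ∷ 4 ∷ 5 ∷ 6 ∷ 7 ∷ 8 ∷ 9 ∷ 10 ∷ 11 ∷ 12 ∷ 13 ∷ 14 ∷ 15 ∷ 16 ∷ 17 ∷ 18 ∷ 19 ∷ 20 ∷ 21 ∷ []) ∷
  (1F , 0 ∷ 1 ∷ 2 ∷ 3 ∷ 4 ∷ 5 ∷ 6 ∷ 7 ∷ 8 ∷ 9 ∷ 10 ∷ 11 ∷ 12 ∷ 13 ∷ 14 ∷ 15 ∷ 16 ∷ 17 ∷ 18 ∷ 19 ∷ 20 ∷ 21 ∷ []) ∷
  (2F , 0 ∷ 1 ∷ 2 ∷ 3 ∷ 4 ∷ 5 ∷ 6 ∷ 7 ∷ 8 ∷ 9 ∷ 10 ∷ 11 ∷ 12 ∷ 13 ∷ 14 ∷ 15 ∷ 16 ∷ 17 ∷ 18 ∷ 19 ∷ 20 ∷ 21 ∷ []) ∷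
  (0F , 0 ∷ 1 ∷ 2 ∷ 3 ∷ 4 ∷ 5 ∷ 7 ∷ 6 ∷ 8 ∷ 9 ∷ 11 ∷ 10 ∷ 13 ∷ 12 ∷ 17 ∷ 16 ∷ 14 ∷ 15 ∷ 18 ∷ 19 ∷ 20 ∷ 21 ∷ []) ∷
  (3F , 0 ∷ 1 ∷ 2 ∷ 3 ∷ 4 ∷ 5 ∷ 6 ∷ 7 ∷ 8 ∷ 9 ∷ 10 ∷ 11 ∷ 13 ∷ 12 ∷ 15 ∷ 14 ∷ 16 ∷ 17 ∷ 18 ∷ 19 ∷ 20 ∷ 21 ∷ []) ∷
  (5F , 0 ∷ 3 ∷ 1 ∷ 2 ∷ 8 ∷ 9 ∷ 5 ∷ 4 ∷ 7 ∷ 6 ∷ 19 ∷ 18 ∷ 21 ∷ 20 ∷ 13 ∷ 12 ∷ 11 ∷ 10 ∷ 17 ∷ 16 ∷ 15 ∷ 14 ∷ []) ∷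
  (4F , 0 ∷ 1 ∷ 2 ∷ 3 ∷ 4 ∷ 5 ∷ 6 ∷ 7 ∷ 8 ∷ 9 ∷ 11 ∷ 10 ∷ 12 ∷ 13 ∷ 14 ∷ 15 ∷ 16 ∷ 17 ∷ 18 ∷ 19 ∷ 20 ∷ 21 ∷ []) ∷
  (0F , 0 ∷ 1 ∷ 2 ∷ 3 ∷ 4 ∷ 5 ∷ 6 ∷ 7 ∷ 9 ∷ 8 ∷ 11 ∷ 10 ∷ 12 ∷ 13 ∷ 14 ∷ 15 ∷ 17 ∷ 16 ∷ 21 ∷ 20 ∷ 19 ∷ 18 ∷ []) ∷
  (5F , 0 ∷ 1 ∷ 2 ∷ 3 ∷ 4 ∷ 5 ∷ 6 ∷ 7 ∷ 8 ∷ 9 ∷ 11 ∷ 10 ∷ 12 ∷ 13 ∷ 14 ∷ 15 ∷ 16 ∷ 17 ∷ 18 ∷ 19 ∷ 20 ∷ 21 ∷ []) ∷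
  (5F , 0 ∷ 1 ∷ 2 ∷ 3 ∷ 4 ∷ 5 ∷ 6 ∷ 7 ∷ 8 ∷ 9 ∷ 11 ∷ 10 ∷ 12 ∷ 13 ∷ 14 ∷ 15 ∷ 17 ∷ 16 ∷ 18 ∷ 19 ∷ 21 ∷ 20 ∷ []) ∷
  (5F , 0 ∷ 3 ∷ 1 ∷ 2 ∷ 8 ∷ 9 ∷ 4 ∷ 5 ∷ 7 ∷ 6 ∷ 19 ∷ 18 ∷ 21 ∷ 20 ∷ 11 ∷ 10 ∷ 13 ∷ 12 ∷ 17 ∷ 16 ∷ 15 ∷ 14 ∷ []) ∷
  (5F , 0 ∷ 3 ∷ 1 ∷ 2 ∷ 8 ∷ 9 ∷ 5 ∷ 4 ∷ 6 ∷ 7 ∷ 19 ∷ 18 ∷ 21 ∷ 20 ∷ 13 ∷ 12 ∷ 11 ∷ 10 ∷ 15 ∷ 14 ∷ 16 ∷ 17 ∷ []) ∷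
  (5F , 0 ∷ 3 ∷ 1 ∷ 2 ∷ 8 ∷ 9 ∷ 5 ∷ 4 ∷ 7 ∷ 6 ∷ 19 ∷ 18 ∷ 21 ∷ 20 ∷ 13 ∷ 12 ∷ 10 ∷ 11 ∷ 17 ∷ 16 ∷ 14 ∷ 15 ∷ []) ∷
  (3F , 0 ∷ 2 ∷ 1 ∷ 3 ∷ 6 ∷ 7 ∷ 4 ∷ 5 ∷ 8 ∷ 9 ∷ 14 ∷ 15 ∷ 16 ∷ 17 ∷ 11 ∷ 10 ∷ 12 ∷ 13 ∷ 18 ∷ 19 ∷ 20 ∷ 21 ∷ []) ∷
  (4F , 0 ∷ 2 ∷ 1 ∷ 3 ∷ 6 ∷ 7 ∷ 4 ∷ 5 ∷ 8 ∷ 9 ∷ 15 ∷ 14 ∷ 17 ∷ 16 ∷ 10 ∷ 11 ∷ 12 ∷ 13 ∷ 18 ∷ 19 ∷ 20 ∷ 21 ∷ []) ∷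
  (0F , 0 ∷ 2 ∷ 1 ∷ 3 ∷ 6 ∷ 7 ∷ 5 ∷ 4 ∷ 8 ∷ 9 ∷ 14 ∷ 15 ∷ 16 ∷ 17 ∷ 12 ∷ 13 ∷ 11 ∷ 10 ∷ 18 ∷ 19 ∷ 20 ∷ 21 ∷ []) ∷
  (0F , 0 ∷ 2 ∷ 1 ∷ 3 ∷ 6 ∷ 7 ∷ 4 ∷ 5 ∷ 8 ∷ 9 ∷ 15 ∷ 14 ∷ 17 ∷ 16 ∷ 10 ∷ 11 ∷ 12 ∷ 13 ∷ 18 ∷ 19 ∷ 20 ∷ 21 ∷ []) ∷
  (5F , 0 ∷ 2 ∷ 1 ∷ 3 ∷ 6 ∷ 7 ∷ 4 ∷ 5 ∷ 8 ∷ 9 ∷ 15 ∷ 14 ∷ 17 ∷ 16 ∷ 10 ∷ 11 ∷ 12 ∷ 13 ∷ 18 ∷ 19 ∷ 20 ∷ 21 ∷ []) ∷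
  (5F , 0 ∷ 2 ∷ 1 ∷ 3 ∷ 6 ∷ 7 ∷ 4 ∷ 5 ∷ 8 ∷ 9 ∷ 15 ∷ 14 ∷ 17 ∷ 16 ∷ 10 ∷ 11 ∷ 13 ∷ 12 ∷ 18 ∷ 19 ∷ 21 ∷ 20 ∷ []) ∷
  (2F , 0 ∷ 1 ∷ 2 ∷ 3 ∷ 4 ∷ 5 ∷ 7 ∷ 6 ∷ 9 ∷ 8 ∷ 11 ∷ 10 ∷ 12 ∷ 13 ∷ 17 ∷ 16 ∷ 15 ∷ 14 ∷ 21 ∷ 20 ∷ 19 ∷ 18 ∷ []) ∷
  (1F , 0 ∷ 1 ∷ 2 ∷ 3 ∷ 4 ∷ 5 ∷ 7 ∷ 6 ∷ 9 ∷ 8 ∷ 11 ∷ 10 ∷ 13 ∷ 12 ∷ 17 ∷ 16 ∷ 15 ∷ 14 ∷ 21 ∷ 20 ∷ 19 ∷ 18 ∷ []) ∷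
  (1F , 0 ∷ 1 ∷ 2 ∷ 3 ∷ 4 ∷ 5 ∷ 7 ∷ 6 ∷ 9 ∷ 8 ∷ 11 ∷ 10 ∷ 13 ∷ 12 ∷ 17 ∷ 16 ∷ 15 ∷ 14 ∷ 21 ∷ 20 ∷ 19 ∷ 18 ∷ []) ∷
  (4F , 1 ∷ 4 ∷ 0 ∷ 5 ∷ 10 ∷ 11 ∷ 2 ∷ 3 ∷ 12 ∷ 13 ∷ 19 ∷ 14 ∷ 15 ∷ 18 ∷ 6 ∷ 7 ∷ 8 ∷ 9 ∷ 16 ∷ 21 ∷ 20 ∷ 17 ∷ []) ∷
  (4F , 1 ∷ 4 ∷ 0 ∷ 5 ∷ 10 ∷ 11 ∷ 2 ∷ 3 ∷ 12 ∷ 13 ∷ 19 ∷ 14 ∷ 15 ∷ 18 ∷ 6 ∷ 7 ∷ 8 ∷ 9 ∷ 17 ∷ 20 ∷ 21 ∷ 16 ∷ []) ∷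
  (0F , 1 ∷ 4 ∷ 0 ∷ 5 ∷ 10 ∷ 11 ∷ 2 ∷ 3 ∷ 13 ∷ 12 ∷ 20 ∷ 14 ∷ 15 ∷ 18 ∷ 6 ∷ 7 ∷ 8 ∷ 9 ∷ 19 ∷ 17 ∷ 16 ∷ 21 ∷ []) ∷
  (0F , 1 ∷ 4 ∷ 0 ∷ 5 ∷ 10 ∷ 11 ∷ 2 ∷ 3 ∷ 12 ∷ 13 ∷ 20 ∷ 14 ∷ 15 ∷ 18 ∷ 6 ∷ 7 ∷ 8 ∷ 9 ∷ 19 ∷ 16 ∷ 17 ∷ 21 ∷ []) ∷
  (0F , 1 ∷ 4 ∷ 0 ∷ 5 ∷ 10 ∷ 11 ∷ 2 ∷ 3 ∷ 12 ∷ 13 ∷ 20 ∷ 14 ∷ 15 ∷ 18 ∷ 6 ∷ 7 ∷ 8 ∷ 9 ∷ 19 ∷ 17 ∷ 16 ∷ 21 ∷ []) ∷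
  (0F , 1 ∷ 4 ∷ 0 ∷ 5 ∷ 10 ∷ 11 ∷ 2 ∷ 3 ∷ 13 ∷ 12 ∷ 20 ∷ 14 ∷ 15 ∷ 18 ∷ 6 ∷ 7 ∷ 8 ∷ 9 ∷ 19 ∷ 16 ∷ 17 ∷ 21 ∷ []) ∷
  (0F , 1 ∷ 4 ∷ 0 ∷ 5 ∷ 10 ∷ 11 ∷ 3 ∷ 2 ∷ 13 ∷ 12 ∷ 14 ∷ 19 ∷ 18 ∷ 16 ∷ 8 ∷ 9 ∷ 7 ∷ 6 ∷ 17 ∷ 20 ∷ 21 ∷ 15 ∷ []) ∷
  (0F , 1 ∷ 4 ∷ 0 ∷ 5 ∷ 10 ∷ 11 ∷ 3 ∷ 2 ∷ 12 ∷ 13 ∷ 14 ∷ 19 ∷ 18 ∷ 16 ∷ 8 ∷ 9 ∷ 7 ∷ 6 ∷ 17 ∷ 21 ∷ 20 ∷ 15 ∷ []) ∷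
  (0F , 1 ∷ 4 ∷ 0 ∷ 5 ∷ 10 ∷ 11 ∷ 3 ∷ 2 ∷ 12 ∷ 13 ∷ 14 ∷ 19 ∷ 18 ∷ 16 ∷ 8 ∷ 9 ∷ 7 ∷ 6 ∷ 17 ∷ 20 ∷ 21 ∷ 15 ∷ []) ∷
  (0F , 1 ∷ 4 ∷ 0 ∷ 5 ∷ 10 ∷ 11 ∷ 3 ∷ 2 ∷ 13 ∷ 12 ∷ 14 ∷ 19 ∷ 18 ∷ 16 ∷ 8 ∷ 9 ∷ 7 ∷ 6 ∷ 17 ∷ 21 ∷ 20 ∷ 15 ∷ []) ∷
  (0F , 2 ∷ 6 ∷ 0 ∷ 7 ∷ 14 ∷ 15 ∷ 3 ∷ 1 ∷ 17 ∷ 16 ∷ 10 ∷ 18 ∷ 19 ∷ 12 ∷ 8 ∷ 9 ∷ 5 ∷ 4 ∷ 13 ∷ 21 ∷ 20 ∷ 11 ∷ []) ∷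
  (0F , 2 ∷ 6 ∷ 0 ∷ 7 ∷ 14 ∷ 15 ∷ 3 ∷ 1 ∷ 16 ∷ 17 ∷ 10 ∷ 18 ∷ 19 ∷ 12 ∷ 8 ∷ 9 ∷ 5 ∷ 4 ∷ 13 ∷ 20 ∷ 21 ∷ 11 ∷ []) ∷
  (0F , 0 ∷ 1 ∷ 2 ∷ 3 ∷ 4 ∷ 5 ∷ 7 ∷ 6 ∷ 9 ∷ 8 ∷ 10 ∷ 11 ∷ 13 ∷ 12 ∷ 17 ∷ 16 ∷ 15 ∷ 14 ∷ 21 ∷ 20 ∷ 19 ∷ 18 ∷ []) ∷
  [])

recognised : List Edge → Bool
recognised E = any (λ c → does (certifies? E c)) certificates

module _ {G : Graph} (cubic : Cubic G) (girth : GirthAtLeast G 5) where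

  certifies⇒≅ : ∀ (L : Labelling G) {E} c → AllPartners L E → Certifies E c → G ≅ graph (proj₁ c)
  certifies⇒≅ L {E} (k , π) links (chords , branches , surjective , injective) =
    cubic-embedding⇒≅ (girth⇒simple {G} girth) (graph-simple k) cubic (graph-cubic k) φ
      (λ e → present⇒near L links (edges e))
    where
    open Labelling L

    φ : Fin 22 ↔ Graph.V G
    φ = mk↔ₛ′ (at ∘ lookup π) (λ v → proj₁ (surjective (of v)))
      (λ v → trans (cong at (proj₂ (surjective (of v)))) (at-of v))
      (λ v → injective _ _ (trans (proj₂ (surjective _)) (of-at _)))

    edges : ∀ e → Present E (lookup π (proj₁ (graphEnds k e))) (lookup π (proj₂ (graphEnds k e)))
    edges e with splitAt 21 e
    ... | inj₁ i = branches i
    ... | inj₂ n = chords n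

  recognised⇒≅ : ∀ (L : Labelling G) E → AllPartners L E → T (recognised E) → ∃[ k ] G ≅ graph k
  recognised⇒≅ L E links t =
    let c , _ , v = find (Any.any⁻ (λ c → does (certifies? E c)) certificates t)
    in proj₁ c , certifies⇒≅ L c links (does⁻ (certifies? E c) v)

-- Refuting binary constraints by backtracking

module _ {X A : Set} (domain : List A) (conflict : X → A → X → A → Bool) where

  refuted : List X → List (X × A) → Bool
  refuted []       _ = false
  refuted (x ∷ xs) σ = all (λ a → any (λ (y , b) → conflict x a y b) σ ∨ refuted xs ((x , a) ∷ σ)) domain

  -- The branch that always chooses `f x` never meets a conflict and reaches the empty list, which
  -- counts as not refuted. This holds for any list, so the order affects only the cost.
  refuted-sound : (f : X → A) → (∀ x → f x ∈ domain) → (∀ x y → ¬ T (conflict x (f x) y (f y))) →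
                  ∀ xs {σ} → All (λ (y , b) → f y ≡ b) σ → ¬ T (refuted xs σ)
  refuted-sound f f∈ sat (x ∷ xs) {σ} agree t =
    [ (λ c → sat-σ agree (Any.any⁻ _ σ c)) , refuted-sound f f∈ sat xs (refl ∷ agree) ]′
    (Equivalence.to T-∨ (All.lookup (All.all⁺ _ domain t) (f∈ x)))
    where
    sat-σ : ∀ {σ} → All (λ (y , b) → f y ≡ b) σ → ¬ Any (λ (y , b) → T (conflict x (f x) y b)) σ
    sat-σ (refl ∷ _) (here c)  = sat x _ c
    sat-σ (_ ∷ agree) (there c) = sat-σ agree c

-- Refuting edge colourings

module _ (G : Graph) where
  open Graph G using (V; E; ends; Incident)

  Meet : E → E → Set
  Meet e f = proj₁ (ends e) ≡ proj₁ (ends f) ⊎ proj₁ (ends e) ≡ proj₂ (ends f) ⊎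
             proj₂ (ends e) ≡ proj₁ (ends f) ⊎ proj₂ (ends e) ≡ proj₂ (ends f)

  meet? : ∀ e f → Dec (Meet e f × e ≢ f)
  meet? e f =
    (proj₁ (ends e) ≟ proj₁ (ends f) ⊎-dec proj₁ (ends e) ≟ proj₂ (ends f) ⊎-dec
     proj₂ (ends e) ≟ proj₁ (ends f) ⊎-dec proj₂ (ends e) ≟ proj₂ (ends f)) ×-dec ¬? (e ≟ f)

  meeting : E → List E
  meeting e = filter (meet? e) (allFin (size G))

  meetingTable : Vec (List E) (size G)
  meetingTable = tabulate meeting

  open DecMembership (_≟_ {size G}) using (_∈?_)

  clash : Vec (List E) (size G) → E → Fin 3 → E → Fin 3 → Bool
  clash M e a f b = does (a ≟ b) ∧ does (f ∈? lookup M e)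

  uncolourable : List E → Bool
  uncolourable order = refuted (allFin 3) (clash meetingTable) order []

  uncolourable-sound : ∀ order → uncolourable order ≡ true → ¬ EdgeColoring G 3
  uncolourable-sound order eq (c , proper) =
    refuted-sound (allFin 3) (clash meetingTable) c (λ e → ∈-allFin (c e)) no-clash order [] (Equivalence.from T-≡ eq)
    where
    distinct : ∀ {e f} → Meet e f × e ≢ f → c e ≢ c f
    distinct (inj₁ eq               , e≢f) = proper _ _ _ e≢f (inj₁ refl) (inj₁ eq)
    distinct (inj₂ (inj₁ eq)        , e≢f) = proper _ _ _ e≢f (inj₁ refl) (inj₂ eq)
    distinct (inj₂ (inj₂ (inj₁ eq)) , e≢f) = proper _ _ _ e≢f (inj₂ refl) (inj₁ eq)
    distinct (inj₂ (inj₂ (inj₂ eq)) , e≢f) = proper _ _ _ e≢f (inj₂ refl) (inj₂ eq)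

    no-clash : ∀ e f → ¬ T (clash meetingTable e (c e) f (c f))
    no-clash e f t =
      let same , f∈ = Equivalence.to T-∧ t
      in distinct (proj₂ (∈-filter⁻ (meet? e) {xs = allFin (size G)}
           (subst (f ∈_) (lookup∘tabulate meeting e) (does⁻ (f ∈? lookup meetingTable e) f∈))))
           (does⁻ (c e ≟ c f) same)

-- Refuting isomorphisms

module _ (G H : Graph) where
  open DecMembership (_≟_ {order G}) using () renaming (_∈?_ to _∈G?_)
  open DecMembership (_≟_ {order H}) using () renaming (_∈?_ to _∈H?_)

  -- Tests for an injective map preserving adjacency. Adjacent vertices need no test of injectivity,
  -- as their images are adjacent and hence distinct.
  mismatch : Vec (List (Fin (order G))) (order G) → Vec (List (Fin (order H))) (order H) →
             Fin (order G) → Fin (order H) → Fin (order G) → Fin (order H) → Bool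
  mismatch N M x a y b =
    if does (y ∈G? lookup N x) then not (does (b ∈H? lookup M a)) else does (a ≟ b) ∧ not (does (x ≟ y))

  nonisomorphic : List (Fin (order G)) → Bool
  nonisomorphic xs = refuted (allFin (order H)) (mismatch (neighbourTable G) (neighbourTable H)) xs []

  nonisomorphic-sound : ∀ xs → nonisomorphic xs ≡ true → ¬ (G ≅ H)
  nonisomorphic-sound xs eq iso = refuted-sound (allFin (order H)) (mismatch N M) f (λ x → ∈-allFin (f x)) sat xs []
    (Equivalence.from T-≡ eq)
    where
    N = neighbourTable G
    M = neighbourTable H
    f = Inverse.to (_≅_.vertices iso)

    sat : ∀ x y → ¬ T (mismatch N M x (f x) y (f y))
    sat x y t with y ∈G? lookup N x
    ... | no _   = not-equal (Equivalence.to T-∧ t)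
      where
      not-equal : T (does (f x ≟ f y)) × T (not (does (x ≟ y))) → ⊥
      not-equal (p , q) with x ≟ y
      ... | no x≢y = x≢y (↔-injective (_≅_.vertices iso) (does⁻ (f x ≟ f y) p))
    ... | yes y∈ with f y ∈H? lookup M (f x)
    ...   | no ∉ = ∉ (∈-neighbourTable H (adj-map iso (neighbourTable-adj G y∈)))

-- Searching for small cuts

not-xor-not : ∀ a b → not a xor not b ≡ a xor b
not-xor-not true  b = refl
not-xor-not false b = Bool.not-involutive b

xor-not : ∀ s → s xor not s ≡ true
xor-not true  = refl
xor-not false = refl

toll : Bool → ℕ
toll c = if c then 1 else 0

-- With the budget exhausted the answer is `true`: the partition cuts too many edges to be of
-- concern.
pay : Bool → ℕ → (ℕ → Bool) → Bool
pay false b       k = k b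
pay true  zero    k = true
pay true  (suc b) k = k b

module _ {n : ℕ} where

  assigned : Fin n → List (Fin n × Bool) → Maybe Bool
  assigned v []            = nothing
  assigned v ((u , s) ∷ σ) = if does (v ≟ u) then just s else assigned v σ

  Flat : Bool → List (Fin n × Bool) → Set
  Flat s σ = All (λ (x , a) → All (λ (y , b) → a ≡ s → b ≡ s → x ≡ y) σ) σ

  flat? : ∀ s σ → Dec (Flat s σ)
  flat? s σ = All.all? (λ (x , a) → All.all? (λ (y , b) → (a Bool.≟ s) →-dec (b Bool.≟ s) →-dec (x ≟ y)) σ) σ

  trivial : List (Fin n × Bool) → Bool
  trivial σ = all (λ v → is-just (assigned v σ)) (allFin n) ∧ (does (flat? true σ) ∨ does (flat? false σ))

  -- Every partition of the vertices that extends σ and cuts at most b of the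
  -- given edges is trivial.
  onlyTrivial : List (Fin n × Fin n) → List (Fin n × Bool) → ℕ → Bool
  onlyTrivial []             σ b = trivial σ
  onlyTrivial ((u , v) ∷ es) σ b = continue (assigned u σ) (assigned v σ)
    where
    continue : Maybe Bool → Maybe Bool → Bool
    -- Failing is the safe answer. It does not arise for the six graphs from root 0, whose edge
    -- lists begin with the tree edges in the order of their lower ends.
    continue nothing  _        = false
    continue (just s) (just t) = pay (s xor t) b (onlyTrivial es σ)
    continue (just s) nothing  = onlyTrivial es ((v , s) ∷ σ) b ∧ pay true b (onlyTrivial es ((v , not s) ∷ σ))

  module _ (side : Fin n → Bool) where

    crossings : List (Fin n × Fin n) → ℕ
    crossings []             = 0
    crossings ((u , v) ∷ es) = toll (side u xor side v) ℕ.+ crossings es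

    Agrees : List (Fin n × Bool) → Set
    Agrees = All λ (v , s) → side v ≡ s

    assigned-sound : ∀ {v s σ} → Agrees σ → assigned v σ ≡ just s → side v ≡ s
    assigned-sound {v} {σ = (u , _) ∷ _} (p ∷ agrees) eq with v ≟ u
    assigned-sound (p ∷ agrees) refl | yes refl = p
    assigned-sound (p ∷ agrees) eq   | no _     = assigned-sound agrees eq

    assigned-∈ : ∀ {v σ} → Agrees σ → T (is-just (assigned v σ)) → (v , side v) ∈ σ
    assigned-∈ {v} {(u , _) ∷ _} (p ∷ agrees) t with v ≟ u
    ... | yes refl = here (cong (v ,_) p)
    ... | no _     = there (assigned-∈ agrees t)

    pay-sound : ∀ c b {m k} → toll c ℕ.+ m ≤ b → T (pay c b k) → ∃[ b′ ] m ≤ b′ × T (k b′)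
    pay-sound false b       m≤b       t = b , m≤b , t
    pay-sound true  (suc b) (s≤s m≤b) t = b , m≤b , t

    Trivial : Set
    Trivial = ∃[ s ] (∀ x y → side x ≡ s → side y ≡ s → x ≡ y)

    flat-sound : ∀ {s σ} → (∀ v → (v , side v) ∈ σ) → Flat s σ → ∀ x y → side x ≡ s → side y ≡ s → x ≡ y
    flat-sound ∈σ flat x y = All.lookup (All.lookup flat (∈σ x)) (∈σ y)

    trivial-sound : ∀ {σ} → Agrees σ → T (trivial σ) → Trivial
    trivial-sound {σ} agrees t =
      let covers , flat = Equivalence.to T-∧ t
          ∈σ = λ v → assigned-∈ {σ = σ} agrees (All.lookup (All.all⁺ _ (allFin n) covers) (∈-allFin v))
      in [ (λ f → true , flat-sound ∈σ (does⁻ (flat? true σ) f)) ,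
           (λ f → false , flat-sound ∈σ (does⁻ (flat? false σ) f)) ]′ (Equivalence.to T-∨ flat)

    onlyTrivial-sound : ∀ es {σ b} → Agrees σ → crossings es ≤ b → T (onlyTrivial es σ b) → Trivial
    onlyTrivial-sound [] {σ} agrees le t = trivial-sound {σ} agrees t
    onlyTrivial-sound ((u , v) ∷ es) {σ} {b} agrees le t with assigned u σ in p | assigned v σ in q
    ... | just s | just s′ =
      let b′ , le′ , t′ = pay-sound (s xor s′) b
            (subst₂ (λ x y → toll (x xor y) ℕ.+ crossings es ≤ b)
              (assigned-sound {σ = σ} agrees p) (assigned-sound {σ = σ} agrees q) le) t
      in onlyTrivial-sound es agrees le′ t′
    ... | just s | nothing = cases (side v Bool.≟ s)
      where
      side-u = assigned-sound {σ = σ} agrees p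

      cases : Dec (side v ≡ s) → Trivial
      cases (yes eq) = onlyTrivial-sound es (eq ∷ agrees)
        (ℕ.≤-trans (ℕ.m≤n+m _ _) le) (proj₁ (Equivalence.to T-∧ t))
      cases (no ≢s) =
        let side-v = Bool.¬-not ≢s
            b′ , le′ , t′ = pay-sound true b
              (subst (λ c → toll c ℕ.+ crossings es ≤ b)
                (trans (cong₂ _xor_ side-u side-v) (xor-not s)) le)
              (proj₂ (Equivalence.to T-∧ t))
        in onlyTrivial-sound es (side-v ∷ agrees) le′ t′

crossings-tabulate : ∀ {n m} (side : Fin n → Bool) (f : Fin m → Fin n × Fin n) →
  crossings side (List.tabulate f) ≡ ∣ tabulate (λ e → side (proj₁ (f e)) xor side (proj₂ (f e))) ∣
crossings-tabulate {m = zero}  side f = refl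
crossings-tabulate {m = suc m} side f with side (proj₁ (f zero)) xor side (proj₂ (f zero))
... | true  = cong suc (crossings-tabulate side (f ∘ suc))
... | false = crossings-tabulate side (f ∘ suc)

trivial-not : ∀ {n} {side : Fin n → Bool} → Trivial (not ∘ side) → Trivial side
trivial-not (s , unique) = not s , λ x y p q → unique x y (trans (cong not p) (Bool.not-involutive s))
                                                          (trans (cong not q) (Bool.not-involutive s))

crossings-not : ∀ {n} (side : Fin n → Bool) es → crossings (not ∘ side) es ≡ crossings side es
crossings-not side []             = refl
crossings-not side ((u , v) ∷ es) =
  cong₂ (λ c m → toll c ℕ.+ m) (not-xor-not (side u) (side v)) (crossings-not side es)

hasOnlyTrivialCuts : (G : Graph) → Fin (order G) → Bool
hasOnlyTrivialCuts G r = onlyTrivial (List.tabulate (Graph.ends G)) ((r , true) ∷ []) 3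

-- Complementing a side changes neither its cut nor its triviality, so the search may put `r` on the
-- side `true`.
hasOnlyTrivialCuts-sound : ∀ G r → hasOnlyTrivialCuts G r ≡ true → CyclicallyEdgeConnected 4 G
hasOnlyTrivialCuts-sound G r checked = onlyTrivialCuts⇒cyclically4EdgeConnected {G} λ side small →
  from side (side r) refl (subst (_≤ 3) (sym (crossings-tabulate side (Graph.ends G))) small)
  where
  es = List.tabulate (Graph.ends G)
  t  = Equivalence.from T-≡ checked

  from : ∀ side s → side r ≡ s → crossings side es ≤ 3 → Trivial side
  from side true  eq le = onlyTrivial-sound side es (eq ∷ []) le t
  from side false eq le = trivial-not (onlyTrivial-sound (not ∘ side) es (cong not eq ∷ [])
    (subst (_≤ 3) (sym (crossings-not side es)) le) t)

-- The three snarks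

snark : Fin 3 → Graph
snark i = graph (i ↑ˡ 3)

-- Orders of the edges and vertices that make the backtracking fail early.
colourOrder : Fin 3 → List (Fin 33)
colourOrder 0F = map (_mod 33) (22 ∷ 10 ∷ 25 ∷ 3 ∷ 9 ∷ 0 ∷ 4 ∷ 12 ∷ 11 ∷ 21 ∷ 23 ∷ 13 ∷ 24 ∷ 28 ∷ 1 ∷ 2 ∷ 5 ∷ 6 ∷ 14 ∷ 15 ∷ 16 ∷ 27 ∷ 32 ∷ 7 ∷ 8 ∷ 17 ∷ 18 ∷ 20 ∷ 30 ∷ 26 ∷ 19 ∷ 29 ∷ 31 ∷ [])
colourOrder 1F = map (_mod 33) (27 ∷ 15 ∷ 25 ∷ 6 ∷ 16 ∷ 1 ∷ 5 ∷ 13 ∷ 14 ∷ 23 ∷ 26 ∷ 28 ∷ 32 ∷ 0 ∷ 2 ∷ 3 ∷ 4 ∷ 10 ∷ 9 ∷ 11 ∷ 21 ∷ 12 ∷ 22 ∷ 24 ∷ 30 ∷ 18 ∷ 7 ∷ 17 ∷ 8 ∷ 20 ∷ 19 ∷ 29 ∷ 31 ∷ [])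
colourOrder 2F = map (_mod 33) (21 ∷ 9 ∷ 30 ∷ 3 ∷ 10 ∷ 0 ∷ 4 ∷ 11 ∷ 12 ∷ 23 ∷ 24 ∷ 22 ∷ 31 ∷ 1 ∷ 2 ∷ 5 ∷ 6 ∷ 13 ∷ 14 ∷ 16 ∷ 28 ∷ 15 ∷ 25 ∷ 26 ∷ 27 ∷ 29 ∷ 17 ∷ 7 ∷ 18 ∷ 32 ∷ 8 ∷ 19 ∷ 20 ∷ [])

abstract
  snark-noShortCycles : ∀ i → NoShortCycles (neighbourTable (snark i))
  snark-noShortCycles = from-yes (all? λ i → noShortCycles? (neighbourTable (snark i)))

  snark-uncolourable : ∀ i → uncolourable (snark i) (colourOrder i) ≡ true
  snark-uncolourable 0F = refl
  snark-uncolourable 1F = refl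
  snark-uncolourable 2F = refl

  snark-onlyTrivialCuts : ∀ i → hasOnlyTrivialCuts (snark i) 0F ≡ true
  snark-onlyTrivialCuts 0F = refl
  snark-onlyTrivialCuts 1F = refl
  snark-onlyTrivialCuts 2F = refl

vertexOrder vertexOrder′ : List (Fin 22)
vertexOrder  = map (_mod 22) (10 ∷ 4 ∷ 1 ∷ 5 ∷ 12 ∷ 11 ∷ 13 ∷ 14 ∷ 0 ∷ 6 ∷ 2 ∷ 7 ∷ 16 ∷ 17 ∷ 3 ∷ 18 ∷ 8 ∷ 9 ∷ 20 ∷ 15 ∷ 19 ∷ 21 ∷ [])
vertexOrder′ = map (_mod 22) (10 ∷ 4 ∷ 1 ∷ 5 ∷ 12 ∷ 11 ∷ 13 ∷ 0 ∷ 14 ∷ 2 ∷ 6 ∷ 7 ∷ 17 ∷ 15 ∷ 16 ∷ 18 ∷ 20 ∷ 3 ∷ 8 ∷ 9 ∷ 19 ∷ 21 ∷ [])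

abstract
  snark-nonisomorphic₀₁ : nonisomorphic (snark 0F) (snark 1F) vertexOrder ≡ true
  snark-nonisomorphic₀₁ = refl

  snark-nonisomorphic₀₂ : nonisomorphic (snark 0F) (snark 2F) vertexOrder ≡ true
  snark-nonisomorphic₀₂ = refl

  snark-nonisomorphic₁₂ : nonisomorphic (snark 1F) (snark 2F) vertexOrder′ ≡ true
  snark-nonisomorphic₁₂ = refl

snark₀≇snark₁ : ¬ (snark 0F ≅ snark 1F)
snark₀≇snark₁ = nonisomorphic-sound (snark 0F) (snark 1F) vertexOrder snark-nonisomorphic₀₁

snark₀≇snark₂ : ¬ (snark 0F ≅ snark 2F)
snark₀≇snark₂ = nonisomorphic-sound (snark 0F) (snark 2F) vertexOrder snark-nonisomorphic₀₂

snark₁≇snark₂ : ¬ (snark 1F ≅ snark 2F)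
snark₁≇snark₂ = nonisomorphic-sound (snark 1F) (snark 2F) vertexOrder′ snark-nonisomorphic₁₂

snark-injective : ∀ i j → snark i ≅ snark j → i ≡ j
snark-injective 0F 0F _   = refl
snark-injective 0F 1F iso = contradiction iso snark₀≇snark₁
snark-injective 0F 2F iso = contradiction iso snark₀≇snark₂
snark-injective 1F 0F iso = contradiction (≅-sym iso) snark₀≇snark₁
snark-injective 1F 1F _   = refl
snark-injective 1F 2F iso = contradiction iso snark₁≇snark₂
snark-injective 2F 0F iso = contradiction (≅-sym iso) snark₀≇snark₂
snark-injective 2F 1F iso = contradiction (≅-sym iso) snark₁≇snark₂
snark-injective 2F 2F _   = refl

treeEdges : Subset 33
treeEdges = Vec.replicate 21 inside Vec.++ Vec.replicate 12 outside

abstract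
  treeEdges-ends : ∀ k (i : Fin 21) → graphEnds k (member treeEdges i) ≡ (parent i , suc i)
  treeEdges-ends = from-yes (all? λ k → all? λ i → ≡-dec _≟_ _≟_ (graphEnds k (member treeEdges i)) (parent i , suc i))

T₃≅spanning : ∀ k → T₃ ≅ spanningSubgraph (graph k) treeEdges
T₃≅spanning k = record
  { vertices = ↔-id _
  ; edges    = ↔-id _
  ; joins    = λ i u v → Sum.map (trans (treeEdges-ends k i)) (trans (treeEdges-ends k i))
  }

snark-isT₃Snark : ∀ i → IsT₃Snark (snark i)
snark-isT₃Snark i = record
  { isSnark = record
    { cyclically4EdgeConnected = hasOnlyTrivialCuts-sound (snark i) 0F (snark-onlyTrivialCuts i)
    ; cubic                    = graph-cubic (i ↑ˡ 3)
    ; girth≥5                  = noShortCycles⇒girth≥5 (snark i) (graph-simple (i ↑ˡ 3)) (snark-noShortCycles i)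
    ; not3EdgeColorable        = uncolourable-sound (snark i) (colourOrder i) (snark-uncolourable i)
    }
  ; spanningTree≅T₃ = treeEdges , tree-map (T₃≅spanning (i ↑ˡ 3)) (IsT₃.isTree T₃-isT₃) , ≅-sym (T₃≅spanning (i ↑ˡ 3))
  }

-- The three graphs with a small cyclic cut

-- The side `false` is a cycle of six leaves with the inner vertices 1, 4, 5 and, in the first
-- graph, 6. Only tree edges are cut: two in the first graph, three in the others.
cutSides : Vec (Vec Bool 22) 3
cutSides =
  (t ∷ f ∷ t ∷ t ∷ f ∷ f ∷ f ∷ t ∷ t ∷ t ∷ f ∷ f ∷ f ∷ f ∷ f ∷ f ∷ t ∷ t ∷ t ∷ t ∷ t ∷ t ∷ []) ∷
  (t ∷ f ∷ t ∷ t ∷ f ∷ f ∷ t ∷ t ∷ t ∷ t ∷ f ∷ f ∷ f ∷ f ∷ f ∷ t ∷ f ∷ t ∷ t ∷ t ∷ t ∷ t ∷ []) ∷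
  (t ∷ f ∷ t ∷ t ∷ f ∷ f ∷ t ∷ t ∷ t ∷ t ∷ f ∷ f ∷ f ∷ f ∷ f ∷ t ∷ t ∷ t ∷ f ∷ t ∷ t ∷ t ∷ []) ∷
  []
  where
  t = true
  f = false

-- Each is a pentagon: a chord between leaves with adjacent stems' parent in common, closed by the
-- tree path between them.
cutCycles : Bool → Vec (Vec (Fin 22) 5) 3
cutCycles true  = (# 3 ∷ # 9 ∷ # 20 ∷ # 18 ∷ # 8 ∷ []) ∷ (# 3 ∷ # 9 ∷ # 20 ∷ # 18 ∷ # 8 ∷ []) ∷ (# 2 ∷ # 7 ∷ # 16 ∷ # 15 ∷ # 6 ∷ []) ∷ []
cutCycles false = (# 1 ∷ # 5 ∷ # 12 ∷ # 10 ∷ # 4 ∷ []) ∷ (# 1 ∷ # 5 ∷ # 12 ∷ # 10 ∷ # 4 ∷ []) ∷ (# 1 ∷ # 5 ∷ # 12 ∷ # 10 ∷ # 4 ∷ []) ∷ []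

cutSide : Fin 3 → Fin 22 → Bool
cutSide j = lookup (lookup cutSides j)

cutCycle : Fin 3 → Bool → Fin 5 → Fin 22
cutCycle j b = lookup (lookup (cutCycles b) j)

abstract
  cut-small : ∀ j → ∣ cut (graph (3 ↑ʳ j)) (cutSide j) ∣ ≤ 3
  cut-small = from-yes (all? λ j → ∣ cut (graph (3 ↑ʳ j)) (cutSide j) ∣ ℕ.≤? 3)

  cutCycle-valid : ∀ j b →
    (∀ x y → cutCycle j b x ≡ cutCycle j b y → x ≡ y) ×
    (∀ x → Adj (graph (3 ↑ʳ j)) (cutCycle j b x) (cutCycle j b (next x))) ×
    (∀ x → cutSide j (cutCycle j b x) ≡ b)
  cutCycle-valid = λ { j true → from-yes (all? λ j → valid? j true) j ; j false → from-yes (all? λ j → valid? j false) j }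
    where
    valid? : ∀ j b → Dec (
      (∀ x y → cutCycle j b x ≡ cutCycle j b y → x ≡ y) ×
      (∀ x → Adj (graph (3 ↑ʳ j)) (cutCycle j b x) (cutCycle j b (next x))) ×
      (∀ x → cutSide j (cutCycle j b x) ≡ b))
    valid? j b =
      all? (λ x → all? λ y → (cutCycle j b x ≟ cutCycle j b y) →-dec (x ≟ y)) ×-dec
      all? (λ x → adj? (graph (3 ↑ʳ j)) (cutCycle j b x) (cutCycle j b (next x))) ×-dec
      all? (λ x → cutSide j (cutCycle j b x) Bool.≟ b)

graph-smallCut : ∀ j → SmallCyclicCut (graph (3 ↑ʳ j))
graph-smallCut j = record
  { side   = cutSide j
  ; small  = cut-small j
  ; cyclic = λ b → record
    { vertex           = cutCycle j b
    ; vertex-injective = λ {x} {y} → proj₁ (cutCycle-valid j b) x y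
    ; vertex-adj       = proj₁ (proj₂ (cutCycle-valid j b))
    ; nondegenerate    = from-yes (nondegenerate? 5)
    ; on-side          = proj₂ (proj₂ (cutCycle-valid j b))
    }
  }

-- The classification of `T₃`-snarks

spanningTree⇒labelling : ∀ {G} → HasSpanningTree≅ G T₃ → Labelling G
spanningTree⇒labelling {G} (S , _ , iso) = record
  { vertices = ↔-sym (_≅_.vertices iso)
  ; tree     = λ adj → let i , j = adj-map (≅-sym iso) adj in member S i , j
  }

-- Each level of the search visits a leaf, so depth 20 is never reached.
abstract
  explored : Search.explore recognised 20 root ≡ true
  explored = refl

-- Of the two outcomes of the search, an accepted edge set is recognised as one of the six graphs,
-- and a surviving colouring contradicts the absence of 3-edge-colourings.
T₃Snark⇒graph : ∀ d → Search.explore recognised d root ≡ true → ∀ G → IsT₃Snark G → ∃[ k ] G ≅ graph k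
T₃Snark⇒graph d searched G isT₃Snark = Soundness.search-sound {G} cubic girth≥5 recognised
  (recognised⇒≅ {G} cubic girth≥5)
  (λ L E c links saturated proper →
    ⊥-elim (not3EdgeColorable (properColouring⇒edgeColoring {G} cubic girth≥5 L links saturated proper)))
  d searched (spanningTree⇒labelling {G} spanningTree≅T₃)
  where
  open IsT₃Snark isT₃Snark
  open IsSnark isSnark

T₃Snark⇒snark : ∀ G → IsT₃Snark G → ∃[ i ] G ≅ snark i
T₃Snark⇒snark G isT₃Snark = let k , iso = T₃Snark⇒graph 20 explored G isT₃Snark in classify k iso
  where
  open IsT₃Snark isT₃Snark
  open IsSnark isSnark

  classify : ∀ k → G ≅ graph k → ∃[ i ] G ≅ snark i
  classify k iso with splitAt 3 k in eq
  ... | inj₁ i = i , subst (λ k → G ≅ graph k) (sym (Fin.splitAt⁻¹-↑ˡ {i = k} eq)) iso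
  -- Here cyclic 4-edge-connectivity excludes the three graphs with a small cut.
  ... | inj₂ j = contradiction cyclically4EdgeConnected (smallCut⇒¬cyclically4EdgeConnected (smallCut-map iso
    (subst SmallCyclicCut (cong graph (Fin.splitAt⁻¹-↑ʳ {i = k} eq)) (graph-smallCut j))))

mainTheorem4 : Σ[ S ∈ (Fin 3 → Graph) ]
    ((∀ i → IsT₃Snark (S i)) ×
    (∀ i j → S i ≅ S j → i ≡ j) ×
    (∀ G → IsT₃Snark G → ∃[ i ] (G ≅ S i)))
mainTheorem4 = snark , snark-isT₃Snark , snark-injective , T₃Snark⇒snark
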